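{- Let $L/\mathbb{F}_q$ be a field extension, complete for a valuation $\nu:L\to\mathbb{Q}\cup\{\infty\}$; let $\Sigma\subset\mathbb{N}^*$ be finite and let $\delta_i:A\to L$ ($i\in\Sigma$) and $\gamma:A\to L$ be injective $\mathbb{F}_q$-linear maps such that $\nu(\delta_i(a))\in\{0,\infty\}$ for all $i\in\Sigma$, $a\in A$, and $\gamma(a)^{ -1}\to0$ as $a$ runs in $A\setminus\{0\}$. For all $m,n>0$ and all semi-characters $\sigma,\psi$ we have $$\mathcal{F}_m^\sigma\,\mathcal{F}_n^\psi\subset\mathcal{F}^{\sigma\psi}_{m+n},$$ and the $\mathbb{F}_p$-vector space $\mathcal{F}=\sum_{n,\sigma}\mathcal{F}_n^\sigma$ is an $\mathbb{F}_p$-algebra.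
   Context: $q$ is a power of a prime $p$, $A=\mathbb{F}_q[\theta]$, $A^+$ the set of monic polynomials of $A$. Write $\gamma_a=\gamma(a)$. A semi-character is a map $A\to L$ of the form $a\mapsto\prod_{i\in\Sigma}\delta_i(a)^{\alpha_i}$ with $\alpha_i\in\mathbb{N}$; $\boldsymbol{1}$ is the trivial one, constant equal to $1$. For semi-characters $\sigma_1,\dots,\sigma_r$ and integers $n_1,\dots,n_r\ge1$, $$f_A\begin{pmatrix} \sigma_1 & \cdots & \sigma_r \\ n_1 & \cdots & n_r \end{pmatrix}=\sum\frac{\sigma_1(a_1)\cdots\sigma_r(a_r)}{\gamma_{a_1}^{n_1}\cdots\gamma_{a_r}^{n_r}}\in L,$$ the (convergent) sum being over $a_1,\dots,a_r\in A^+$ with $\deg_\theta(a_1)>\cdots>\deg_\theta(a_r)\ge0$. For $n>0$ and a semi-character $\sigma$, $\mathcal{F}^\sigma_n$ is the $\mathbb{F}_p$-subspace of $L$ generated by the elements $f_A\begin{pmatrix} \sigma_1 & \cdots & \sigma_r \\ n_1 & \cdots & n_r \end{pmatrix}$ with $r>0$, $\prod_i\sigma_i=\sigma$, $\sum_in_i=n$, all $n_i>0$. Also $\mathcal{F}_0^{\boldsymbol{1}}=\mathbb{F}_p$ and $\mathcal{F}^\sigma_0=(0)$ if $\sigma\ne\boldsymbol{1}$. -}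

module Defs where

open import Level using (Level; _⊔_; suc)
open import Algebra.Core using (Op₁)
open import Algebra.Bundles using (CommutativeRing)
open import Algebra.Morphism.Structures using (module RingMorphisms)
open import Algebra.Module.Bundles.Raw using (RawLeftModule)
open import Algebra.Module.Morphism.Structures using (module LeftModuleMorphisms)
import Algebra.Properties.Semiring.Exp as Exp
import Algebra.Properties.Semiring.Mult as Mult
open import Data.Fin.Base using (Fin; toℕ)
open import Data.List.Base as List using (List; []; _∷_; map; foldr; tabulate; concatMap; cartesianProductWith; upTo)
open import Data.List.Relation.Unary.Any using (Any)
open import Data.Nat.Base as ℕ using (ℕ)
open import Data.Product.Base using (Σ; ∃; _×_; _,_)
open import Data.Rational.Base as ℚ using (ℚ; 0ℚ)
open import Data.Sum.Base using (_⊎_)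
open import Data.Vec.Base as Vec using (Vec; []; _∷_; zipWith)
open import Data.Vec.Relation.Unary.All using (All)
open import Function.Base using (_$_)
open import Function.Bundles using (Inverse)
open import Relation.Binary.PropositionalEquality.Core using (_≡_)
import Relation.Binary.PropositionalEquality.Properties as ≡
import Relation.Binary.Construct.Add.Supremum.NonStrict as AddSup
open import Relation.Nullary.Construct.Add.Supremum using (_⁺; [_]; ⊤⁺)
open import Relation.Nullary.Negation.Core using (¬_)
open import Relation.Unary using (Pred; _∈_)

private
  variable
    c ℓ c′ ℓ′ g : Level

------------------------------------------------------------------------
-- Fields

-- The value of _⁻¹ at 0# is unspecified and never matters.
record Field c ℓ : Set (suc (c ⊔ ℓ)) where
  field
    commutativeRing : CommutativeRing c ℓ

  open CommutativeRing commutativeRing public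

  infix 9 _⁻¹

  field
    _⁻¹        : Op₁ Carrier
    ⁻¹-cong    : ∀ {x y} → x ≈ y → (x ⁻¹) ≈ (y ⁻¹)
    1≉0        : ¬ (1# ≈ 0#)
    ⁻¹-inverse : ∀ {x} → ¬ (x ≈ 0#) → (x ⁻¹) * x ≈ 1#

  open Exp semiring public using (_^_)
  open Mult semiring public using () renaming (_×_ to _·_)

  ∑ ∏ : List Carrier → Carrier
  ∑ = foldr _+_ 0#
  ∏ = foldr _*_ 1#

  ∏ᵛ : ∀ {n} → Vec Carrier n → Carrier
  ∏ᵛ = Vec.foldr′ _*_ 1#

HasCardinality : ℕ → Field c ℓ → Set (c ⊔ ℓ)
HasCardinality q F = Inverse (≡.setoid (Fin q)) (Field.setoid F)

IsFieldHomomorphism : (F : Field c ℓ) (L : Field c′ ℓ′) →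
                      (Field.Carrier F → Field.Carrier L) → Set (c ⊔ ℓ ⊔ ℓ′)
IsFieldHomomorphism F L =
  RingMorphisms.IsRingHomomorphism (Field.rawRing F) (Field.rawRing L)

------------------------------------------------------------------------
-- Valuations and convergence

ℚ∞ : Set
ℚ∞ = ℚ ⁺

pattern ∞ = ⊤⁺

open AddSup ℚ._≤_ public using () renaming (_≤⁺_ to _≤∞_)

infixl 6 _+∞_
infixl 7 _⊓∞_

_+∞_ : ℚ∞ → ℚ∞ → ℚ∞
[ a ] +∞ [ b ] = [ a ℚ.+ b ]
[ a ] +∞ ∞     = ∞
∞     +∞ b     = ∞

_⊓∞_ : ℚ∞ → ℚ∞ → ℚ∞
[ a ] ⊓∞ [ b ] = [ a ℚ.⊓ b ]
[ a ] ⊓∞ ∞     = [ a ]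
∞     ⊓∞ b     = b

module _ (L : Field c ℓ) (ν : Field.Carrier L → ℚ∞) where
  open Field L

  record IsValuation : Set (c ⊔ ℓ) where
    field
      cong   : ∀ {x y} → x ≈ y → ν x ≡ ν y
      0⇒∞    : ∀ {x} → x ≈ 0# → ν x ≡ ∞
      ∞⇒0    : ∀ {x} → ν x ≡ ∞ → x ≈ 0#
      *-homo : ∀ x y → ν (x * y) ≡ ν x +∞ ν y
      +-min  : ∀ x y → (ν x ⊓∞ ν y) ≤∞ ν (x + y)

  ConvergesTo : (ℕ → Carrier) → Carrier → Set
  ConvergesTo u l = ∀ (M : ℚ) → ∃ λ N → ∀ n → N ℕ.≤ n → [ M ] ≤∞ ν (u n - l)

  IsCauchy : (ℕ → Carrier) → Set
  IsCauchy u = ∀ (M : ℚ) → ∃ λ N → ∀ m n → N ℕ.≤ m → N ℕ.≤ n →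
               [ M ] ≤∞ ν (u m - u n)

  IsComplete : Set c
  IsComplete = ∀ u → IsCauchy u → ∃ λ l → ConvergesTo u l

------------------------------------------------------------------------
-- The polynomials F[θ], as a graded F-vector space: their product plays
-- no role in what follows

module Polynomial (F : Field c ℓ) where
  open Field F

  -- x₀ ∷ x₁ ∷ … ∷ xₙ ∷ [] is x₀ + x₁ θ + … + xₙ θⁿ; leading zeros are
  -- allowed, and disregarded by _≈ᴬ_.
  Poly : Set c
  Poly = List Carrier

  coeff : Poly → ℕ → Carrier
  coeff []      _         = 0#
  coeff (x ∷ a) ℕ.zero    = x
  coeff (x ∷ a) (ℕ.suc n) = coeff a n

  infix  4 _≈ᴬ_
  infixl 6 _+ᴬ_

  _≈ᴬ_ : Poly → Poly → Set ℓ
  a ≈ᴬ b = ∀ n → coeff a n ≈ coeff b n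

  _+ᴬ_ : Poly → Poly → Poly
  []      +ᴬ b       = b
  (x ∷ a) +ᴬ []      = x ∷ a
  (x ∷ a) +ᴬ (y ∷ b) = (x + y) ∷ (a +ᴬ b)

  rawLeftModule : RawLeftModule Carrier c ℓ
  rawLeftModule = record
    { Carrierᴹ = Poly
    ; _≈ᴹ_     = _≈ᴬ_
    ; _+ᴹ_     = _+ᴬ_
    ; _*ₗ_     = λ x → map (x *_)
    ; 0ᴹ       = []
    ; -ᴹ_      = map (-_)
    }

  module _ {q : ℕ} (card : HasCardinality q F) where

    -- The monic polynomials of degree d, each listed exactly once.
    monics : ℕ → List Poly
    monics ℕ.zero    = (1# ∷ []) ∷ []
    monics (ℕ.suc d) = cartesianProductWith _∷_ (tabulate (Inverse.to card)) (monics d)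

    -- All (a₁ , … , aᵣ), aᵢ monic, with D > deg a₁ > ⋯ > deg aᵣ.
    chains : (r D : ℕ) → List (Vec Poly r)
    chains ℕ.zero    D = [] ∷ []
    chains (ℕ.suc r) D =
      concatMap (λ d → cartesianProductWith _∷_ (monics d) (chains r d)) (upTo D)

------------------------------------------------------------------------
-- F-linear maps F[θ] → L, for a field extension ι : F → L

module _ (F : Field c ℓ) (L : Field c′ ℓ′)
         (ι : Field.Carrier F → Field.Carrier L) where
  private
    module F = Field F
    module L = Field L
  open Polynomial F

  extensionRawLeftModule : RawLeftModule F.Carrier c′ ℓ′
  extensionRawLeftModule = record
    { Carrierᴹ = L.Carrier
    ; _≈ᴹ_     = L._≈_
    ; _+ᴹ_     = L._+_
    ; _*ₗ_     = λ x y → ι x L.* y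
    ; 0ᴹ       = L.0#
    ; -ᴹ_      = L.-_
    }

  IsInjectiveLinear : (Poly → L.Carrier) → Set (c ⊔ ℓ ⊔ ℓ′)
  IsInjectiveLinear =
    LeftModuleMorphisms.IsLeftModuleMonomorphism rawLeftModule extensionRawLeftModule

module _ (F : Field c ℓ) (L : Field c′ ℓ′) (ν : Field.Carrier L → ℚ∞) where
  open Polynomial F
  open Field L using (Carrier; _⁻¹)

  -- γ(a)⁻¹ → 0 along the cofinite filter of F[θ] ∖ {0}.
  InverseTendsToZero : (Poly → Carrier) → Set (c ⊔ ℓ)
  InverseTendsToZero γ = ∀ (M : ℚ) → ∃ λ (exceptions : List Poly) →
    ∀ a → ¬ (a ≈ᴬ []) → ¬ Any (a ≈ᴬ_) exceptions → [ M ] ≤∞ ν (γ a ⁻¹)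

------------------------------------------------------------------------
-- 𝔽ₚ-subspaces and 𝔽ₚ-subalgebras of a field L of characteristic p

module PrimeField (p : ℕ) (L : Field c ℓ) where
  open Field L

  𝔽ₚ : Pred Carrier ℓ
  𝔽ₚ x = ∃ λ (k : Fin p) → x ≈ toℕ k · 1#

  data Span (G : Pred Carrier g) : Pred Carrier (c ⊔ ℓ ⊔ g) where
    gen-∈   : ∀ {x} → x ∈ G → x ∈ Span G
    0-∈     : 0# ∈ Span G
    +-∈     : ∀ {x y} → x ∈ Span G → y ∈ Span G → (x + y) ∈ Span G
    scale-∈ : ∀ {k x} → k ∈ 𝔽ₚ → x ∈ Span G → (k * x) ∈ Span G
    resp-∈  : ∀ {x y} → x ≈ y → x ∈ Span G → y ∈ Span G

  record IsSubalgebra (S : Pred Carrier g) : Set (c ⊔ ℓ ⊔ g) where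
    field
      resp-≈   : ∀ {x y} → x ≈ y → x ∈ S → y ∈ S
      0-closed : 0# ∈ S
      +-closed : ∀ {x y} → x ∈ S → y ∈ S → (x + y) ∈ S
      ·-closed : ∀ {k x} → k ∈ 𝔽ₚ → x ∈ S → (k * x) ∈ S
      1-closed : 1# ∈ S
      *-closed : ∀ {x y} → x ∈ S → y ∈ S → (x * y) ∈ S

------------------------------------------------------------------------
-- Multiple sums and the spaces they generate

module MultipleSums
  (p : ℕ) {q : ℕ}
  (F : Field c ℓ) (card : HasCardinality q F)
  (L : Field c′ ℓ′) (ν : Field.Carrier L → ℚ∞)
  (I : List ℕ)
  (δ : ℕ → Polynomial.Poly F → Field.Carrier L)
  (γ : Polynomial.Poly F → Field.Carrier L)
  where

  open Field L
  open Polynomial F using (Poly; chains)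
  open PrimeField p L public

  _≗_ : (σ ψ : Poly → Carrier) → Set (c ⊔ ℓ′)
  σ ≗ ψ = ∀ a → σ a ≈ ψ a

  𝟏 : Poly → Carrier
  𝟏 _ = 1#

  _⊗_ : (σ ψ : Poly → Carrier) → Poly → Carrier
  (σ ⊗ ψ) a = σ a * ψ a

  ⨂ : ∀ {r} → Vec (Poly → Carrier) r → Poly → Carrier
  ⨂ = Vec.foldr′ _⊗_ 𝟏

  IsSemiCharacter : (Poly → Carrier) → Set (c ⊔ ℓ′)
  IsSemiCharacter σ = ∃ λ (α : ℕ → ℕ) →
    σ ≗ λ a → ∏ (map (λ i → δ i a ^ α i) I)

  term : ∀ {r} → Vec (Poly → Carrier) r → Vec ℕ r → Vec Poly r → Carrier
  term σs ns as = ∏ᵛ (zipWith _$_ σs as) * ∏ᵛ (zipWith (λ a n → γ a ^ n) as ns) ⁻¹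

  partialSum : ∀ {r} → Vec (Poly → Carrier) r → Vec ℕ r → ℕ → Carrier
  partialSum {r} σs ns D = ∑ (map (term σs ns) (chains card r D))

  -- x = f_A (σs ; ns): the tuples are exhausted according to deg a₁.
  IsMultipleSum : ∀ {r} → Vec (Poly → Carrier) r → Vec ℕ r → Carrier → Set
  IsMultipleSum σs ns x = ConvergesTo L ν (partialSum σs ns) x

  record Generator (n : ℕ) (σ : Poly → Carrier) (x : Carrier) : Set (c ⊔ c′ ⊔ ℓ′) where
    field
      {r}            : ℕ
      r>0            : 0 ℕ.< r
      σs             : Vec (Poly → Carrier) r
      ns             : Vec ℕ r
      semiCharacters : All IsSemiCharacter σs
      ns>0           : All (0 ℕ.<_) ns
      ⨂σs≗σ          : ⨂ σs ≗ σ
      ∑ns≡n          : Vec.sum ns ≡ n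
      isMultipleSum  : IsMultipleSum σs ns x

  -- The two constructors in weight 0 describe 𝔽ₚ if σ = 𝟏 and (0) otherwise,
  -- without deciding which case holds.
  data 𝓕 : ℕ → (Poly → Carrier) → Pred Carrier (c ⊔ c′ ⊔ ℓ′) where
    weight0-one  : ∀ {σ x} → σ ≗ 𝟏 → x ∈ 𝔽ₚ → x ∈ 𝓕 0 σ
    weight0-zero : ∀ {σ x} → x ≈ 0# → x ∈ 𝓕 0 σ
    positive     : ∀ {n σ x} → 0 ℕ.< n → x ∈ Span (Generator n σ) → x ∈ 𝓕 n σ

  -- The sum of a family of subspaces is the span of their union.
  𝓕-total : Pred Carrier (c ⊔ c′ ⊔ ℓ′)
  𝓕-total = Span λ x → ∃ λ n → Σ (Poly → Carrier) λ σ → IsSemiCharacter σ × x ∈ 𝓕 n σ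

{-# OPTIONS --safe #-}

-- The partial sums over deg a₁ < D multiply, for every D, by a quasi-shuffle
-- rule whose coefficients do not depend on D; the theorem follows on letting
-- D → ∞. The rule reduces to the product of two power sums over the monic
-- polynomials of one degree d. Its diagonal is again a power sum. Off the
-- diagonal, partial fractions trade 1/(γ(a) γ(b)) for the factor 1/γ(b - a),
-- so that only one of a, b is left in the denominator besides b - a; the
-- semi-character of the other is expanded by additivity, and b - a = x c with
-- x ∈ F ∖ {0} and c monic of degree < d is summed over x, which gives 0 or -1.

module Submission where

open import Defs
open import Algebra.Module.Morphism.Structures using (module LeftModuleMorphisms)
open import Algebra.Morphism.Structures using (module RingMorphisms)
import Algebra.Properties.AbelianGroup as AbelianGroupProperties
import Algebra.Properties.CommutativeMonoid.Sum as VectorSum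
import Algebra.Properties.CommutativeSemigroup as CommutativeSemigroupProperties
import Algebra.Properties.CommutativeSemiring.Exp as CommutativeExp
import Algebra.Properties.Ring as RingProperties
import Algebra.Properties.Semiring.Exp as ExpProperties
import Algebra.Properties.Semiring.Mult as MultProperties
import Algebra.Solver.Ring.NaturalCoefficients.Default as NaturalSolver
open import Data.Fin.Base as Fin using (Fin; zero; suc)
open import Data.Fin.Permutation using (permutation)
import Data.Fin.Properties as Fin
open import Data.List.Base as List using (List; []; _∷_; _++_; map; tabulate; concatMap; cartesianProductWith; upTo; applyUpTo)
open import Data.List.Membership.Propositional using () renaming (_∈_ to _∈ˡ_)
import Data.List.Properties as List
import Data.List.Relation.Unary.All as All
open import Data.List.Relation.Unary.All using (All; []; _∷_)
import Data.List.Relation.Unary.All.Properties as All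
open import Data.List.Relation.Unary.AllPairs using ([]; _∷_)
open import Data.List.Relation.Unary.Any as Any using (Any; here; there)
open import Data.List.Relation.Unary.Unique.Propositional using (Unique)
open import Data.Nat.Base as ℕ using (ℕ; _<_; zero; suc)
open import Data.Nat.Primality using (Prime; prime⇒nonZero; prime⇒nonTrivial)
import Data.Nat.Properties as ℕ
open import Data.Product.Base using (_×_; _,_; proj₁; proj₂; ∃)
open import Data.Rational.Base as ℚ using (ℚ; 0ℚ)
import Data.Rational.Properties as ℚ
open import Data.Sum.Base using (_⊎_; inj₁; inj₂)
open import Data.Vec.Base as Vec using (Vec; []; _∷_)
import Data.Vec.Relation.Unary.All as VecAll
open import Function.Base using (_∘_)
open import Function.Bundles using (Inverse)
open import Level using (Level; _⊔_)
import Relation.Binary.Construct.Add.Supremum.NonStrict as AddSup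
open import Relation.Binary.PropositionalEquality.Core as ≡ using (_≡_)
import Relation.Binary.PropositionalEquality.Properties as ≡
import Relation.Binary.Reasoning.Setoid as SetoidReasoning
open import Relation.Nullary.Construct.Add.Point using ([]-injective)
open import Relation.Nullary.Construct.Add.Supremum using ([_])
open import Relation.Nullary.Decidable.Core using (yes; no)
open import Relation.Nullary.Negation.Core using (¬_; contradiction)
open import Relation.Unary using (Pred; _∈_)

-- Since every identity is between finite sums, the limit only has to respect combinations with
-- constant coefficients; spans are therefore taken among functions of `D` or `d`. Partial fractions
-- and the expansion by additivity yield nothing but signs. The one coefficient that could leave
-- `𝔽ₚ` is the sum over `x`, and it does not because it is a character sum over the nonzero elements
-- of a finite field: this is where the homogeneity of semi-characters enters. The polynomial `c`
-- has degree below `d`, like the remaining entries of both chains, so its power sum must be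
-- multiplied with their product again. This second product forces an induction on the total depth.
-- Restricted sums, over nonzero scalars or distinct pairs, are formed by subtracting the excluded
-- terms from the full sum. The excluded terms contain inverses of zero, whose value is unspecified,
-- so there are congruence lemmas for these sums that compare summands only where they count.

private
  variable
    a b g h : Level
    A B C : Set a

-- Finite sums, additive functionals and spans of functions

module FieldLemmas {c ℓ : Level} (L : Field c ℓ) where
  open Field L hiding (zero)
  open RingProperties ring public using (-1*x≈-x; -‿distribˡ-*; -‿distribʳ-*)
  open AbelianGroupProperties +-abelianGroup public
    using () renaming (⁻¹-∙-comm to -‿+-comm; ⁻¹-involutive to -‿involutive;
                       x∙y⁻¹≈ε⇒x≈y to x-y≈0⇒x≈y; identityʳ-unique to x+y≈x⇒y≈0; inverseʳ-unique to x+y≈0⇒y≈-x)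
  open SetoidReasoning setoid
  open NaturalSolver commutativeSemiring using (solve; _:=_; _:+_; _:*_)

  x-x≈0 : ∀ {x y} → x ≈ y → x - y ≈ 0#
  x-x≈0 x≈y = trans (+-congʳ x≈y) (-‿inverseʳ _)

  -‿swap : ∀ x y → - (x - y) ≈ y - x
  -‿swap x y = begin
    - (x - y)    ≈⟨ -‿+-comm x (- y) ⟨
    - x - - y    ≈⟨ +-congˡ (-‿involutive y) ⟩
    - x + y      ≈⟨ +-comm _ _ ⟩
    y - x        ∎

  x+y-x≈y : ∀ x y → (x + y) - x ≈ y
  x+y-x≈y x y = begin
    (x + y) - x  ≈⟨ +-congʳ (+-comm x y) ⟩
    (y + x) - x  ≈⟨ +-assoc y x (- x) ⟩
    y + (x - x)  ≈⟨ +-congˡ (-‿inverseʳ x) ⟩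
    y + 0#       ≈⟨ +-identityʳ y ⟩
    y            ∎

  -‿+-interchange : ∀ u v x y → (u + v) - (x + y) ≈ (u - x) + (v - y)
  -‿+-interchange u v x y = begin
    (u + v) - (x + y)      ≈⟨ +-congˡ (-‿+-comm x y) ⟨
    (u + v) + (- x - y)    ≈⟨ solve 4 (λ u v x y → (u :+ v) :+ (x :+ y) := (u :+ x) :+ (v :+ y)) refl u v (- x) (- y) ⟩
    (u - x) + (v - y)      ∎

  *-distribʳ-minus : ∀ x y z → (x - y) * z ≈ x * z - y * z
  *-distribʳ-minus x y z = trans (distribʳ z x (- y)) (+-congˡ (sym (-‿distribˡ-* y z)))

  *-distribˡ-minus : ∀ x y z → z * (x - y) ≈ z * x - z * y
  *-distribˡ-minus x y z = trans (distribˡ z x (- y)) (+-congˡ (sym (-‿distribʳ-* z y)))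

  *-cancel-nonzero : ∀ {x y} → ¬ x ≈ 0# → x * y ≈ 0# → y ≈ 0#
  *-cancel-nonzero {x} {y} x≉0 xy≈0 = begin
    y                ≈⟨ *-identityˡ y ⟨
    1# * y           ≈⟨ *-congʳ (⁻¹-inverse x≉0) ⟨
    (x ⁻¹ * x) * y   ≈⟨ *-assoc _ _ _ ⟩
    x ⁻¹ * (x * y)   ≈⟨ *-congˡ xy≈0 ⟩
    x ⁻¹ * 0#        ≈⟨ zeroʳ _ ⟩
    0#               ∎

  *-nonzero : ∀ {x y} → ¬ x ≈ 0# → ¬ y ≈ 0# → ¬ x * y ≈ 0#
  *-nonzero x≉0 y≉0 xy≈0 = y≉0 (*-cancel-nonzero x≉0 xy≈0)

  ^-nonzero : ∀ {x} n → ¬ x ≈ 0# → ¬ x ^ n ≈ 0#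
  ^-nonzero zero    x≉0 = 1≉0
  ^-nonzero (suc n) x≉0 = *-nonzero x≉0 (^-nonzero n x≉0)

  ⁻¹-unique : ∀ {x y} → x * y ≈ 1# → y ≈ x ⁻¹
  ⁻¹-unique {x} {y} xy≈1 = begin
    y                ≈⟨ *-identityˡ y ⟨
    1# * y           ≈⟨ *-congʳ (⁻¹-inverse x≉0) ⟨
    (x ⁻¹ * x) * y   ≈⟨ *-assoc _ _ _ ⟩
    x ⁻¹ * (x * y)   ≈⟨ *-congˡ xy≈1 ⟩
    x ⁻¹ * 1#        ≈⟨ *-identityʳ _ ⟩
    x ⁻¹             ∎
    where
    x≉0 : ¬ x ≈ 0#
    x≉0 x≈0 = 1≉0 (trans (sym xy≈1) (trans (*-congʳ x≈0) (zeroˡ y)))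

  ⁻¹-distrib-* : ∀ {x y} → ¬ x ≈ 0# → ¬ y ≈ 0# → (x * y) ⁻¹ ≈ x ⁻¹ * y ⁻¹
  ⁻¹-distrib-* {x} {y} x≉0 y≉0 = sym (⁻¹-unique (begin
    (x * y) * (x ⁻¹ * y ⁻¹)
      ≈⟨ solve 4 (λ x y u v → (x :* y) :* (u :* v) := (u :* x) :* (v :* y)) refl x y (x ⁻¹) (y ⁻¹) ⟩
    (x ⁻¹ * x) * (y ⁻¹ * y)   ≈⟨ *-cong (⁻¹-inverse x≉0) (⁻¹-inverse y≉0) ⟩
    1# * 1#                   ≈⟨ *-identityˡ 1# ⟩
    1#                        ∎))

  ⁻¹-distrib-^ : ∀ {x} n → ¬ x ≈ 0# → (x ^ n) ⁻¹ ≈ x ⁻¹ ^ n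
  ⁻¹-distrib-^ zero    x≉0 = sym (⁻¹-unique (*-identityˡ 1#))
  ⁻¹-distrib-^ (suc n) x≉0 =
    trans (⁻¹-distrib-* x≉0 (^-nonzero n x≉0)) (*-congˡ (⁻¹-distrib-^ n x≉0))

  Sum : List A → (A → Carrier) → Carrier
  Sum xs f = ∑ (map f xs)

  Sum-cong : ∀ (xs : List A) {f g} → (∀ x → f x ≈ g x) → Sum xs f ≈ Sum xs g
  Sum-cong []       f≈g = refl
  Sum-cong (x ∷ xs) f≈g = +-cong (f≈g x) (Sum-cong xs f≈g)

  Sum-congᴬ : ∀ {P : Pred A b} {xs} {f g} → All P xs → (∀ {x} → P x → f x ≈ g x) → Sum xs f ≈ Sum xs g
  Sum-congᴬ []         f≈g = refl
  Sum-congᴬ (px ∷ pxs) f≈g = +-cong (f≈g px) (Sum-congᴬ pxs f≈g)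

  Sum-+ : ∀ (xs : List A) f g → Sum xs (λ x → f x + g x) ≈ Sum xs f + Sum xs g
  Sum-+ []       f g = sym (+-identityˡ 0#)
  Sum-+ (x ∷ xs) f g = trans (+-congˡ (Sum-+ xs f g))
    (solve 4 (λ u v x y → (u :+ v) :+ (x :+ y) := (u :+ x) :+ (v :+ y)) refl (f x) (g x) (Sum xs f) (Sum xs g))

  -- Evaluations, finite sums, and multiples and differences of such functionals all have this
  -- property; it supplies both the exchange of sums (`homo-Sum`) and the transport of spans
  -- (`AddSpan-map`).
  record IsAdditive {X : Set a} (Φ : (X → Carrier) → Carrier) : Set (a ⊔ c ⊔ ℓ) where
    field
      cong   : ∀ {f g} → (∀ x → f x ≈ g x) → Φ f ≈ Φ g
      homo-+ : ∀ f g → Φ (λ x → f x + g x) ≈ Φ f + Φ g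

    homo-0 : Φ (λ _ → 0#) ≈ 0#
    homo-0 = x+y≈x⇒y≈0 _ _ (trans (sym (homo-+ _ _)) (cong (λ _ → +-identityˡ 0#)))

    homo-neg : ∀ f → Φ (λ x → - f x) ≈ - Φ f
    homo-neg f = x+y≈0⇒y≈-x _ _ (trans (sym (homo-+ _ _)) (trans (cong (λ x → -‿inverseʳ (f x))) homo-0))

    homo-minus : ∀ f g → Φ (λ x → f x - g x) ≈ Φ f - Φ g
    homo-minus f g = trans (homo-+ _ _) (+-congˡ (homo-neg g))

    homo-Sum : ∀ (ys : List A) (k : A → X → Carrier) → Φ (λ x → Sum ys (λ y → k y x)) ≈ Sum ys (λ y → Φ (k y))
    homo-Sum []       k = homo-0
    homo-Sum (y ∷ ys) k = trans (homo-+ _ _) (+-congˡ (homo-Sum ys k))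

  module _ {X : Set a} where
    eval-additive : (x : X) → IsAdditive (λ f → f x)
    eval-additive x = record { cong = λ f≈g → f≈g x ; homo-+ = λ _ _ → refl }

    Sum-additive : ∀ (ys : List A) {Φ : A → (X → Carrier) → Carrier} → (∀ y → IsAdditive (Φ y)) →
                   IsAdditive (λ f → Sum ys (λ y → Φ y f))
    Sum-additive ys Φ-add = record
      { cong   = λ f≈g → Sum-cong ys (λ y → IsAdditive.cong (Φ-add y) f≈g)
      ; homo-+ = λ f g → trans (Sum-cong ys (λ y → IsAdditive.homo-+ (Φ-add y) f g)) (Sum-+ ys _ _)
      }

    *ˡ-additive : ∀ k {Φ : (X → Carrier) → Carrier} → IsAdditive Φ → IsAdditive (λ f → k * Φ f)
    *ˡ-additive k Φ-add = record
      { cong   = λ f≈g → *-congˡ (IsAdditive.cong Φ-add f≈g)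
      ; homo-+ = λ f g → trans (*-congˡ (IsAdditive.homo-+ Φ-add f g)) (distribˡ k _ _)
      }

    *ʳ-additive : ∀ k {Φ : (X → Carrier) → Carrier} → IsAdditive Φ → IsAdditive (λ f → Φ f * k)
    *ʳ-additive k Φ-add = record
      { cong   = λ f≈g → *-congʳ (IsAdditive.cong Φ-add f≈g)
      ; homo-+ = λ f g → trans (*-congʳ (IsAdditive.homo-+ Φ-add f g)) (distribʳ k _ _)
      }

    minus-additive : ∀ {Φ Ψ : (X → Carrier) → Carrier} → IsAdditive Φ → IsAdditive Ψ → IsAdditive (λ f → Φ f - Ψ f)
    minus-additive Φ-add Ψ-add = record
      { cong   = λ f≈g → +-cong (IsAdditive.cong Φ-add f≈g) (-‿cong (IsAdditive.cong Ψ-add f≈g))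
      ; homo-+ = λ f g → trans
          (+-cong (IsAdditive.homo-+ Φ-add f g) (-‿cong (IsAdditive.homo-+ Ψ-add f g)))
          (-‿+-interchange _ _ _ _)
      }

  Sum-isAdditive : ∀ (xs : List A) → IsAdditive (Sum xs)
  Sum-isAdditive xs = Sum-additive xs eval-additive

  Sum-*ˡ : ∀ (xs : List A) k f → Sum xs (λ x → k * f x) ≈ k * Sum xs f
  Sum-*ˡ []       k f = sym (zeroʳ k)
  Sum-*ˡ (x ∷ xs) k f = trans (+-congˡ (Sum-*ˡ xs k f)) (sym (distribˡ k _ _))

  Sum-*ʳ : ∀ (xs : List A) k f → Sum xs (λ x → f x * k) ≈ Sum xs f * k
  Sum-*ʳ xs k f = trans (Sum-cong xs (λ x → *-comm (f x) k)) (trans (Sum-*ˡ xs k f) (*-comm k _))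

  Sum-1 : ∀ (xs : List A) → Sum xs (λ _ → 1#) ≈ List.length xs · 1#
  Sum-1 []       = refl
  Sum-1 (x ∷ xs) = +-congˡ (Sum-1 xs)

  Sum-swap : ∀ (xs : List A) (ys : List B) (f : A → B → Carrier) →
             Sum xs (λ x → Sum ys (f x)) ≈ Sum ys (λ y → Sum xs (λ x → f x y))
  Sum-swap xs ys f = IsAdditive.homo-Sum (Sum-isAdditive xs) ys (λ y x → f x y)

  Sum-++ : ∀ (xs ys : List A) f → Sum (xs ++ ys) f ≈ Sum xs f + Sum ys f
  Sum-++ []       ys f = sym (+-identityˡ _)
  Sum-++ (x ∷ xs) ys f = trans (+-congˡ (Sum-++ xs ys f)) (sym (+-assoc _ _ _))

  Sum-concatMap : ∀ (k : A → List B) xs f → Sum (concatMap k xs) f ≈ Sum xs (λ x → Sum (k x) f)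
  Sum-concatMap k []       f = refl
  Sum-concatMap k (x ∷ xs) f = trans (Sum-++ (k x) _ f) (+-congˡ (Sum-concatMap k xs f))

  Sum-map : ∀ (k : A → B) xs f → Sum (map k xs) f ≈ Sum xs (f ∘ k)
  Sum-map k []       f = refl
  Sum-map k (x ∷ xs) f = +-congˡ (Sum-map k xs f)

  Sum-cartesianProductWith : ∀ (k : A → B → C) xs ys f →
    Sum (cartesianProductWith k xs ys) f ≈ Sum xs (λ x → Sum ys (λ y → f (k x y)))
  Sum-cartesianProductWith k []       ys f = refl
  Sum-cartesianProductWith k (x ∷ xs) ys f =
    trans (Sum-++ (map (k x) ys) _ f) (+-cong (Sum-map (k x) ys f) (Sum-cartesianProductWith k xs ys f))

  below : ℕ → (ℕ → Carrier) → Carrier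
  below D = Sum (upTo D)

  private
    Sum-applyUpTo : ∀ (k : ℕ → ℕ) D f → Sum (applyUpTo k D) f ≈ ∑ (applyUpTo (f ∘ k) D)
    Sum-applyUpTo k zero    f = refl
    Sum-applyUpTo k (suc D) f = +-congˡ (Sum-applyUpTo (k ∘ suc) D f)

    ∑-applyUpTo-last : ∀ D (u : ℕ → Carrier) → ∑ (applyUpTo u (suc D)) ≈ ∑ (applyUpTo u D) + u D
    ∑-applyUpTo-last zero    u = +-comm _ _
    ∑-applyUpTo-last (suc D) u = trans (+-congˡ (∑-applyUpTo-last D (u ∘ suc))) (sym (+-assoc _ _ _))

  below-head : ∀ D u → below (suc D) u ≈ u 0 + below D (u ∘ suc)
  below-head D u = +-congˡ (trans (Sum-applyUpTo suc D u) (sym (Sum-applyUpTo (λ d → d) D (u ∘ suc))))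

  below-last : ∀ D u → below (suc D) u ≈ below D u + u D
  below-last D u = begin
    below (suc D) u                ≈⟨ Sum-applyUpTo (λ d → d) (suc D) u ⟩
    ∑ (applyUpTo u (suc D))        ≈⟨ ∑-applyUpTo-last D u ⟩
    ∑ (applyUpTo u D) + u D        ≈⟨ +-congʳ (Sum-applyUpTo (λ d → d) D u) ⟨
    below D u + u D                ∎

  -- The square of index pairs is cut into its two open triangles and its diagonal. The strict bound
  -- of the inner `below d` is what makes degrees in a chain strictly decrease.
  below-* : ∀ D u v → below D u * below D v ≈
    (below D (λ d → u d * below d v) + below D (λ d → v d * below d u)) + below D (λ d → u d * v d)
  below-* zero    u v = trans (zeroˡ 0#) (sym (trans (+-identityʳ _) (+-identityʳ _)))
  below-* (suc D) u v = begin
    below (suc D) u * below (suc D) v          ≈⟨ *-cong (below-last D u) (below-last D v) ⟩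
    (below D u + u D) * (below D v + v D)
      ≈⟨ solve 4 (λ U u V v → (U :+ u) :* (V :+ v) := U :* V :+ (u :* V :+ v :* U :+ u :* v)) refl (below D u) (u D) (below D v) (v D) ⟩
    below D u * below D v + (u D * below D v + v D * below D u + u D * v D)
      ≈⟨ +-congʳ (below-* D u v) ⟩
    (x + y + z) + (u D * below D v + v D * below D u + u D * v D)
      ≈⟨ solve 6 (λ x y z r s t → (x :+ y :+ z) :+ (r :+ s :+ t) := (x :+ r) :+ (y :+ s) :+ (z :+ t)) refl x y z _ _ _ ⟩
    (x + u D * below D v) + (y + v D * below D u) + (z + u D * v D)
      ≈⟨ +-cong (+-cong (below-last D _) (below-last D _)) (below-last D _) ⟨
    _ ∎
    where
    x = below D (λ d → u d * below d v)
    y = below D (λ d → v d * below d u)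
    z = below D (λ d → u d * v d)

  -- The members are whole functions, so one integer combination serves all arguments at once; this
  -- uniformity is what lets it survive a limit. Negation is the only scalar because only signs
  -- arise.
  data AddSpan {X : Set a} (G : Pred (X → Carrier) g) : Pred (X → Carrier) (a ⊔ c ⊔ ℓ ⊔ g) where
    gen-∈  : ∀ {f} → f ∈ G → f ∈ AddSpan G
    0-∈    : (λ _ → 0#) ∈ AddSpan G
    +-∈    : ∀ {f f′} → f ∈ AddSpan G → f′ ∈ AddSpan G → (λ x → f x + f′ x) ∈ AddSpan G
    neg-∈  : ∀ {f} → f ∈ AddSpan G → (λ x → - f x) ∈ AddSpan G
    resp-∈ : ∀ {f f′} → (∀ x → f x ≈ f′ x) → f ∈ AddSpan G → f′ ∈ AddSpan G

  module _ {X : Set a} {Y : Set b} {G : Pred (X → Carrier) g} {H : Pred (Y → Carrier) h} where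
    AddSpan-map : ∀ {Φ : (X → Carrier) → Y → Carrier} → (∀ y → IsAdditive (λ f → Φ f y)) →
                  (∀ {f} → f ∈ G → Φ f ∈ AddSpan H) → ∀ {f} → f ∈ AddSpan G → Φ f ∈ AddSpan H
    AddSpan-map Φ-add Φ-gen (gen-∈ f∈G)        = Φ-gen f∈G
    AddSpan-map Φ-add Φ-gen 0-∈                = resp-∈ (λ y → sym (IsAdditive.homo-0 (Φ-add y))) 0-∈
    AddSpan-map Φ-add Φ-gen (+-∈ f∈ f′∈)       = resp-∈ (λ y → sym (IsAdditive.homo-+ (Φ-add y) _ _))
      (+-∈ (AddSpan-map Φ-add Φ-gen f∈) (AddSpan-map Φ-add Φ-gen f′∈))
    AddSpan-map Φ-add Φ-gen (neg-∈ f∈)         = resp-∈ (λ y → sym (IsAdditive.homo-neg (Φ-add y) _))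
      (neg-∈ (AddSpan-map Φ-add Φ-gen f∈))
    AddSpan-map Φ-add Φ-gen (resp-∈ f≈f′ f∈)   = resp-∈ (λ y → IsAdditive.cong (Φ-add y) f≈f′)
      (AddSpan-map Φ-add Φ-gen f∈)

  AddSpan-⊆ : ∀ {X : Set a} {G : Pred (X → Carrier) g} {H : Pred (X → Carrier) h} →
              (∀ {f} → f ∈ G → f ∈ H) → ∀ {f} → f ∈ AddSpan G → f ∈ AddSpan H
  AddSpan-⊆ G⊆H = AddSpan-map eval-additive (λ f∈G → gen-∈ (G⊆H f∈G))

  AddSpan-* : ∀ {X : Set a} {G G′ : Pred (X → Carrier) g} {H : Pred (X → Carrier) h} →
              (∀ {f f′} → f ∈ G → f′ ∈ G′ → (λ x → f x * f′ x) ∈ AddSpan H) →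
              ∀ {f f′} → f ∈ AddSpan G → f′ ∈ AddSpan G′ → (λ x → f x * f′ x) ∈ AddSpan H
  AddSpan-* GG′ f∈ f′∈ =
    AddSpan-map (λ x → *ʳ-additive _ (eval-additive x))
      (λ f∈G → AddSpan-map (λ x → *ˡ-additive _ (eval-additive x)) (GG′ f∈G) f′∈) f∈

-- Sums over `F` and over polynomials of bounded degree

module PolynomialSums {c ℓ c′ ℓ′ : Level} {q : ℕ} (F : Field c ℓ) (card : HasCardinality q F) (L : Field c′ ℓ′) where
  open Field L hiding (zero)
  open FieldLemmas L
  open Polynomial F
  open SetoidReasoning setoid
  private
    module F = Field F
    open Inverse card using (to; from; from-cong; strictlyInverseˡ; strictlyInverseʳ)

  elements : List F.Carrier
  elements = tabulate to

  infixr 7 _•_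
  _•_ : F.Carrier → Poly → Poly
  x • a = map (x F.*_) a

  CongruentF : (F.Carrier → Carrier) → Set _
  CongruentF f = ∀ {x y} → x F.≈ y → f x ≈ f y

  CongruentA : (Poly → Carrier) → Set _
  CongruentA f = ∀ {a b} → a ≈ᴬ b → f a ≈ f b

  ∷-congˡ : ∀ x {a b} → a ≈ᴬ b → (x ∷ a) ≈ᴬ (x ∷ b)
  ∷-congˡ x a≈b zero    = F.refl
  ∷-congˡ x a≈b (suc n) = a≈b n

  ∷-congʳ : ∀ {x y} a → x F.≈ y → (x ∷ a) ≈ᴬ (y ∷ a)
  ∷-congʳ a x≈y zero    = x≈y
  ∷-congʳ a x≈y (suc n) = F.refl

  0∷[]≈[] : ∀ {x} → x F.≈ F.0# → (x ∷ []) ≈ᴬ []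
  0∷[]≈[] x≈0 zero    = x≈0
  0∷[]≈[] x≈0 (suc n) = F.refl


  ≈ᴬ-refl : ∀ a → a ≈ᴬ a
  ≈ᴬ-refl a n = F.refl

  •-congʳ : ∀ {x y} → x F.≈ y → ∀ b → x • b ≈ᴬ y • b
  •-congʳ x≈y []      n       = F.refl
  •-congʳ x≈y (z ∷ b) zero    = F.*-congʳ x≈y
  •-congʳ x≈y (z ∷ b) (suc n) = •-congʳ x≈y b n

  +ᴬ-identityʳ : ∀ a → a ≈ᴬ (a +ᴬ [])
  +ᴬ-identityʳ []      n = F.refl
  +ᴬ-identityʳ (x ∷ a) n = F.refl

  coeff-+ : ∀ a b n → coeff (a +ᴬ b) n F.≈ coeff a n F.+ coeff b n
  coeff-+ []      b       n       = F.sym (F.+-identityˡ _)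
  coeff-+ (x ∷ a) []      n       = F.sym (F.+-identityʳ _)
  coeff-+ (x ∷ a) (y ∷ b) zero    = F.refl
  coeff-+ (x ∷ a) (y ∷ b) (suc n) = coeff-+ a b n

  +ᴬ-congˡ : ∀ a {b b′} → b ≈ᴬ b′ → (a +ᴬ b) ≈ᴬ (a +ᴬ b′)
  +ᴬ-congˡ a {b} {b′} b≈b′ n = F.trans (coeff-+ a b n) (F.trans (F.+-congˡ (b≈b′ n)) (F.sym (coeff-+ a b′ n)))

  private
    Sum-tabulate : ∀ {n} (t : Fin n → A) f → Sum (tabulate t) f ≈ VectorSum.sum +-commutativeMonoid (f ∘ t)
    Sum-tabulate {n = zero}  t f = refl
    Sum-tabulate {n = suc n} t f = +-congˡ (Sum-tabulate (t ∘ suc) f)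

    sum-zero : ∀ {n} (t : Fin n → Carrier) → (∀ j → t j ≈ 0#) → VectorSum.sum +-commutativeMonoid t ≈ 0#
    sum-zero {n = zero}  t t≈0 = refl
    sum-zero {n = suc n} t t≈0 = trans (+-cong (t≈0 zero) (sum-zero (t ∘ suc) (t≈0 ∘ suc))) (+-identityˡ 0#)

    sum-supported : ∀ {n} (t : Fin n → Carrier) i → (∀ j → ¬ j ≡ i → t j ≈ 0#) →
                    VectorSum.sum +-commutativeMonoid t ≈ t i
    sum-supported t zero    t≈0 = trans
      (+-congˡ (sum-zero (t ∘ suc) (λ j → t≈0 (suc j) λ ())))
      (+-identityʳ _)
    sum-supported t (suc i) t≈0 = trans
      (+-cong (t≈0 zero λ ()) (sum-supported (t ∘ suc) i (λ j j≢i → t≈0 (suc j) λ { ≡.refl → j≢i ≡.refl })))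
      (+-identityˡ _)

  -- The maps `φ` and `ψ` are inverse only up to the equality of `F`; conjugating them with the
  -- enumeration gives a genuine permutation of `Fin q`.
  elements-reindex : ∀ (φ ψ : F.Carrier → F.Carrier) →
    (∀ {x y} → x F.≈ y → φ x F.≈ φ y) → (∀ {x y} → x F.≈ y → ψ x F.≈ ψ y) →
    (∀ x → φ (ψ x) F.≈ x) → (∀ x → ψ (φ x) F.≈ x) →
    ∀ {f} → CongruentF f → Sum elements (f ∘ φ) ≈ Sum elements f
  elements-reindex φ ψ φ-cong ψ-cong φψ ψφ {f} f-cong = begin
    Sum elements (f ∘ φ)    ≈⟨ Sum-tabulate to (f ∘ φ) ⟩
    VectorSum.sum +-commutativeMonoid (f ∘ φ ∘ to)
      ≈⟨ VectorSum.sum-cong-≋ +-commutativeMonoid (λ i → f-cong (F.sym (strictlyInverseˡ (φ (to i))))) ⟩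
    VectorSum.sum +-commutativeMonoid (f ∘ to ∘ π)
      ≈⟨ VectorSum.sum-permute +-commutativeMonoid (f ∘ to) (permutation π ρ πρ ρπ) ⟨
    VectorSum.sum +-commutativeMonoid (f ∘ to)
      ≈⟨ Sum-tabulate to f ⟨
    Sum elements f          ∎
    where
    π = from ∘ φ ∘ to
    ρ = from ∘ ψ ∘ to
    πρ : ∀ i → π (ρ i) ≡ i
    πρ i = ≡.trans (from-cong (F.trans (φ-cong (strictlyInverseˡ _)) (φψ _))) (strictlyInverseʳ i)
    ρπ : ∀ i → ρ (π i) ≡ i
    ρπ i = ≡.trans (from-cong (F.trans (ψ-cong (strictlyInverseˡ _)) (ψφ _))) (strictlyInverseʳ i)

  elements-shift : ∀ x {f} → CongruentF f → Sum elements (λ y → f (x F.+ y)) ≈ Sum elements f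
  elements-shift x = elements-reindex (x F.+_) (F.- x F.+_) F.+-congˡ F.+-congˡ
    (λ y → cancel x (F.- x) y (F.-‿inverseʳ x)) (λ y → cancel (F.- x) x y (F.-‿inverseˡ x))
    where
    cancel : ∀ u v y → u F.+ v F.≈ F.0# → u F.+ (v F.+ y) F.≈ y
    cancel u v y uv≈0 = F.trans (F.sym (F.+-assoc u v y)) (F.trans (F.+-congʳ uv≈0) (F.+-identityˡ y))

  elements-scale : ∀ {x} → ¬ x F.≈ F.0# → ∀ {f} → CongruentF f → Sum elements (λ y → f (x F.* y)) ≈ Sum elements f
  elements-scale {x} x≉0 = elements-reindex (x F.*_) (x F.⁻¹ F.*_) F.*-congˡ F.*-congˡ
    (λ y → cancel x (x F.⁻¹) y (F.trans (F.*-comm _ _) (F.⁻¹-inverse x≉0))) (λ y → cancel (x F.⁻¹) x y (F.⁻¹-inverse x≉0))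
    where
    cancel : ∀ u v y → u F.* v F.≈ F.1# → u F.* (v F.* y) F.≈ y
    cancel u v y uv≈1 = F.trans (F.sym (F.*-assoc u v y)) (F.trans (F.*-congʳ uv≈1) (F.*-identityˡ y))

  -- The sum over F ∖ {0}.
  Sum* : (F.Carrier → Carrier) → Carrier
  Sum* f = Sum elements f - f F.0#

  Sum*-additive : IsAdditive Sum*
  Sum*-additive = minus-additive (Sum-isAdditive elements) (eval-additive F.0#)

  Sum*-*ˡ : ∀ k f → Sum* (λ x → k * f x) ≈ k * Sum* f
  Sum*-*ˡ k f = trans (+-congʳ (Sum-*ˡ elements k f)) (sym (*-distribˡ-minus _ _ k))

  Sum-elements : ∀ f → Sum elements f ≈ f F.0# + Sum* f
  Sum-elements f = begin
    Sum elements f                          ≈⟨ x+y-x≈y (f F.0#) _ ⟨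
    (f F.0# + Sum elements f) - f F.0#      ≈⟨ +-assoc _ _ _ ⟩
    f F.0# + Sum* f                         ∎

  -- The difference of the two functions is supported at the index of zero, and exactly that term is
  -- subtracted in `Sum*`.
  Sum*-cong : ∀ {f g} → CongruentF f → CongruentF g → (∀ x → ¬ x F.≈ F.0# → f x ≈ g x) → Sum* f ≈ Sum* g
  Sum*-cong {f} {g} f-cong g-cong f≈g = x-y≈0⇒x≈y _ _ (begin
    Sum* f - Sum* g                             ≈⟨ IsAdditive.homo-minus Sum*-additive f g ⟨
    Sum* k                                      ≈⟨ +-congʳ (Sum-tabulate to k) ⟩
    VectorSum.sum +-commutativeMonoid (k ∘ to) - k F.0#
      ≈⟨ +-congʳ (sum-supported (k ∘ to) (from F.0#) k≈0) ⟩
    k (to (from F.0#)) - k F.0#                 ≈⟨ x-x≈0 (+-cong (f-cong (strictlyInverseˡ _)) (-‿cong (g-cong (strictlyInverseˡ _)))) ⟩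
    0#                                          ∎)
    where
    k = λ x → f x - g x
    k≈0 : ∀ j → ¬ j ≡ from F.0# → k (to j) ≈ 0#
    k≈0 j j≢ = x-x≈0 (f≈g (to j) λ toj≈0 →
      j≢ (≡.trans (≡.sym (strictlyInverseʳ j)) (from-cong toj≈0)))

  Sum*-scale : ∀ {x} → ¬ x F.≈ F.0# → ∀ {f} → CongruentF f → Sum* (λ y → f (x F.* y)) ≈ Sum* f
  Sum*-scale {x} x≉0 f-cong = +-cong (elements-scale x≉0 f-cong) (-‿cong (f-cong (F.zeroʳ x)))

  -- The list has exactly `d + 1` coefficients, so the degree is visible in its shape;
  -- representations padded with zeros are left out.
  data Monic : ℕ → Poly → Set (c ⊔ ℓ) where
    one : ∀ {x} → x F.≈ F.1# → Monic 0 (x ∷ [])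
    _∷_ : ∀ {d a} x → Monic d a → Monic (suc d) (x ∷ a)

  monics-Monic : ∀ d → All (Monic d) (monics card d)
  monics-Monic zero    = one F.refl ∷ []
  monics-Monic (suc d) = All.cartesianProductWith⁺ (≡.setoid _) (≡.setoid _) _∷_ elements (monics card d)
    (λ _ a∈ → _ ∷ All.lookup (monics-Monic d) a∈)

  Monic⇒coeff≈1 : ∀ {d a} → Monic d a → coeff a d F.≈ F.1#
  Monic⇒coeff≈1 (one x≈1) = x≈1
  Monic⇒coeff≈1 (x ∷ a)   = Monic⇒coeff≈1 a

  Monic⇒≉0 : ∀ {d a} → Monic d a → ¬ a ≈ᴬ []
  Monic⇒≉0 {d} a-monic a≈0 = F.1≉0 (F.trans (F.sym (Monic⇒coeff≈1 a-monic)) (a≈0 d))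

  Monic-+ : ∀ {d e a b} → Monic d a → Monic e b → e < d → ∀ x → Monic d (a +ᴬ x • b)
  -- The tail of the first polynomial is opened in both clauses so that adding `[]` to it computes.
  Monic-+ (_ ∷ a@(one _))   (one _) _           x = _ ∷ a
  Monic-+ (_ ∷ a@(_ ∷ _))   (one _) _           x = _ ∷ a
  Monic-+ (_ ∷ a)           (_ ∷ b) (ℕ.s≤s e<d) x = _ ∷ Monic-+ a b e<d x

  Monics : ℕ → (Poly → Carrier) → Carrier
  Monics d = Sum (monics card d)

  Monics-suc : ∀ d f → Monics (suc d) f ≈ Sum elements (λ x → Monics d (λ a → f (x ∷ a)))
  Monics-suc d f = Sum-cartesianProductWith _∷_ elements (monics card d) f

  -- The sum over all polynomials of degree < d.
  Smaller : ℕ → (Poly → Carrier) → Carrier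
  Smaller zero    f = f []
  Smaller (suc d) f = Sum elements (λ x → Smaller d (λ a → f (x ∷ a)))

  Smaller-cong : ∀ d {f g} → (∀ a → f a ≈ g a) → Smaller d f ≈ Smaller d g
  Smaller-cong zero    f≈g = f≈g []
  Smaller-cong (suc d) f≈g = Sum-cong elements (λ x → Smaller-cong d (λ a → f≈g (x ∷ a)))

  MonicsBelow : ℕ → (Poly → Carrier) → Carrier
  MonicsBelow d f = below d (λ e → Monics e f)

  MonicsBelow-isAdditive : ∀ d → IsAdditive (MonicsBelow d)
  MonicsBelow-isAdditive d = Sum-additive (upTo d) (λ e → Sum-isAdditive (monics card e))

  MonicsBelow-*ˡ : ∀ d k f → MonicsBelow d (λ a → k * f a) ≈ k * MonicsBelow d f
  MonicsBelow-*ˡ d k f = trans (Sum-cong (upTo d) (λ e → Sum-*ˡ (monics card e) k f)) (Sum-*ˡ (upTo d) k _)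

  -- Degree 0 is split off rather than the top degree: lists start with the constant term, so a
  -- monic polynomial of positive degree is `x ∷ a` with `a` monic of one degree less.
  MonicsBelow-suc : ∀ d f → MonicsBelow (suc d) f ≈
    f (F.1# ∷ []) + Sum elements (λ x → MonicsBelow d (λ a → f (x ∷ a)))
  MonicsBelow-suc d f = trans (below-head d _) (+-cong (+-identityʳ _)
    (trans (Sum-cong (upTo d) (λ e → Monics-suc e f)) (Sum-swap (upTo d) elements _)))

  -- Leading coefficients agree, and every lower coefficient runs through `F`, which is permuted by
  -- adding the corresponding coefficient of `a`.
  Monics-translate : ∀ {d a} → Monic d a → ∀ {f} → CongruentA f →
                     Monics d f ≈ Smaller d (λ b → f (a +ᴬ b))
  Monics-translate (one x≈1) f-cong = trans (+-identityʳ _) (f-cong (∷-congʳ [] (F.sym x≈1)))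
  Monics-translate {suc d} {x ∷ a} (x ∷ a-monic) {f} f-cong = begin
    Monics (suc d) f
      ≈⟨ Monics-suc d f ⟩
    Sum elements (λ y → Monics d (λ b → f (y ∷ b)))
      ≈⟨ elements-shift x (λ y≈z → Sum-cong (monics card d) (λ b → f-cong (∷-congʳ b y≈z))) ⟨
    Sum elements (λ y → Monics d (λ b → f ((x F.+ y) ∷ b)))
      ≈⟨ Sum-cong elements (λ y → Monics-translate a-monic (λ a≈b → f-cong (∷-congˡ _ a≈b))) ⟩
    Smaller (suc d) (λ b → f ((x ∷ a) +ᴬ b)) ∎

  -- Every nonzero polynomial is uniquely a scalar times a monic one.
  Smaller-monic : ∀ d {f} → CongruentA f →
                  Smaller d f ≈ f [] + Sum* (λ x → MonicsBelow d (λ b → f (x • b)))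
  Smaller-monic zero    {f} f-cong = sym (trans (+-congˡ (IsAdditive.homo-0 Sum*-additive)) (+-identityʳ _))
  Smaller-monic (suc d) {f} f-cong = begin
    Sum elements (λ x → Smaller d (λ a → f (x ∷ a)))
      ≈⟨ Sum-cong elements (λ x → Smaller-monic d (λ a≈b → f-cong (∷-congˡ _ a≈b))) ⟩
    Sum elements (λ x → f (x ∷ []) + Sum* (λ y → MonicsBelow d (λ b → f (x ∷ y • b))))
      ≈⟨ Sum-+ elements _ _ ⟩
    Sum elements (λ x → f (x ∷ [])) + Sum elements (λ x → Sum* (λ y → MonicsBelow d (λ b → f (x ∷ y • b))))
      -- Polynomials with zero tail are the constants: the zero constant becomes `f []`, and the
      -- others are the nonzero multiples of the monic polynomial 1.
      ≈⟨ +-cong (Sum-elements _) (sym (IsAdditive.homo-Sum Sum*-additive elements _)) ⟩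
    (f (F.0# ∷ []) + Sum* (λ x → f (x ∷ []))) + Sum* (λ y → Sum elements (λ x → MonicsBelow d (λ b → f (x ∷ y • b))))
      ≈⟨ +-assoc _ _ _ ⟩
    f (F.0# ∷ []) + (Sum* (λ x → f (x ∷ [])) + Sum* (λ y → Sum elements (λ x → MonicsBelow d (λ b → f (x ∷ y • b)))))
      ≈⟨ +-cong (f-cong (0∷[]≈[] F.refl)) (sym (IsAdditive.homo-+ Sum*-additive _ _)) ⟩
    f [] + Sum* (λ y → f (y ∷ []) + Sum elements (λ x → MonicsBelow d (λ b → f (x ∷ y • b))))
      ≈⟨ +-congˡ (Sum*-cong lhs-cong rhs-cong step) ⟩
    f [] + Sum* (λ y → MonicsBelow (suc d) (λ b → f (y • b))) ∎
    where
    lhs-cong : CongruentF (λ y → f (y ∷ []) + Sum elements (λ x → MonicsBelow d (λ b → f (x ∷ y • b))))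
    lhs-cong y≈z = +-cong (f-cong (∷-congʳ [] y≈z)) (Sum-cong elements (λ x →
      IsAdditive.cong (MonicsBelow-isAdditive d) (λ b → f-cong (∷-congˡ x (•-congʳ y≈z b)))))
    rhs-cong : CongruentF (λ y → MonicsBelow (suc d) (λ b → f (y • b)))
    rhs-cong y≈z = IsAdditive.cong (MonicsBelow-isAdditive (suc d)) (λ b → f-cong (•-congʳ y≈z b))
    -- The constant term `x` is replaced by `y x`, which permutes `F` as `y` is nonzero, so that `y`
    -- becomes a factor of the whole polynomial.
    step : ∀ y → ¬ y F.≈ F.0# →
      f (y ∷ []) + Sum elements (λ x → MonicsBelow d (λ b → f (x ∷ y • b))) ≈ MonicsBelow (suc d) (λ b → f (y • b))
    step y y≉0 = begin
      f (y ∷ []) + Sum elements (λ x → MonicsBelow d (λ b → f (x ∷ y • b)))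
        ≈⟨ +-cong (f-cong (∷-congʳ [] (F.*-identityʳ y))) (elements-scale y≉0 (λ x≈z →
             IsAdditive.cong (MonicsBelow-isAdditive d) (λ b → f-cong (∷-congʳ (y • b) x≈z)))) ⟨
      f (y • (F.1# ∷ [])) + Sum elements (λ x → MonicsBelow d (λ b → f (y • (x ∷ b))))
        ≈⟨ MonicsBelow-suc d (λ b → f (y • b)) ⟨
      MonicsBelow (suc d) (λ b → f (y • b)) ∎

-- Ultrametric limits

module ValuationLemmas {c ℓ : Level} (L : Field c ℓ) (ν : Field.Carrier L → ℚ∞) (isValuation : IsValuation L ν) where
  open Field L hiding (zero)
  open FieldLemmas L
  open SetoidReasoning setoid
  private module ν = IsValuation isValuation
  open AddSup ℚ._≤_ using (_≤⊤⁺; ≤⁺-trans; ≤⁺-reflexive-≡) renaming ([_] to [_]≤)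

  -- The valuation decides vanishing, since only zero has value `∞`. Through `ι` this also settles
  -- whether an element of `F` is zero.
  _≟0 : ∀ x → x ≈ 0# ⊎ ¬ x ≈ 0#
  x ≟0 with ν x in eq
  ... | ∞     = inj₁ (ν.∞⇒0 eq)
  ... | [ v ] = inj₂ λ x≈0 → [v]≢∞ (≡.trans (≡.sym eq) (ν.0⇒∞ x≈0))
    where
    [v]≢∞ : ¬ [ v ] ≡ ∞
    [v]≢∞ ()

  infix 4 _⊑_
  _⊑_ : ℚ → Carrier → Set
  M ⊑ x = [ M ] ≤∞ ν x

  private
    ≤∞-trans : ∀ {u v w} → u ≤∞ v → v ≤∞ w → u ≤∞ w
    ≤∞-trans = ≤⁺-trans ℚ.≤-trans

    ≤∞-reflexive : ∀ {u v} → u ≡ v → u ≤∞ v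
    ≤∞-reflexive = ≤⁺-reflexive-≡ ℚ.≤-reflexive

    ≤∞-⊓ : ∀ {M u v} → [ M ] ≤∞ u → [ M ] ≤∞ v → [ M ] ≤∞ u ⊓∞ v
    ≤∞-⊓ [ p ]≤   [ q ]≤   = [ ℚ.⊓-glb p q ]≤
    ≤∞-⊓ [ p ]≤   (_ ≤⊤⁺)  = [ p ]≤
    ≤∞-⊓ (_ ≤⊤⁺)  v        = v

    ≤∞-+ : ∀ {M K u v} → [ M ] ≤∞ u → [ K ] ≤∞ v → [ M ℚ.+ K ] ≤∞ u +∞ v
    ≤∞-+ [ p ]≤   [ q ]≤   = [ ℚ.+-mono-≤ p q ]≤
    ≤∞-+ [ p ]≤   (_ ≤⊤⁺)  = _ ≤⊤⁺
    ≤∞-+ (_ ≤⊤⁺)  v        = _ ≤⊤⁺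

    [x]+[x]≡[x]⇒x≡0 : ∀ {u} → ¬ u ≡ ∞ → u +∞ u ≡ u → u ≡ [ 0ℚ ]
    [x]+[x]≡[x]⇒x≡0 {∞}     u≢∞ eq = contradiction ≡.refl u≢∞
    [x]+[x]≡[x]⇒x≡0 {[ v ]} u≢∞ eq =
      ≡.cong [_] (AbelianGroupProperties.identityʳ-unique ℚ.+-0-abelianGroup v v ([]-injective eq))

    u+u≡0⇒0≤u : ∀ {u} → u +∞ u ≡ [ 0ℚ ] → [ 0ℚ ] ≤∞ u
    u+u≡0⇒0≤u {∞}     eq = _ ≤⊤⁺
    u+u≡0⇒0≤u {[ v ]} eq = [ ℚ.≮⇒≥ (λ v<0 → ℚ.<-irrefl ([]-injective eq) (ℚ.+-mono-< {v} {0ℚ} {v} {0ℚ} v<0 v<0)) ]≤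

  ⊑-resp : ∀ {M x y} → x ≈ y → M ⊑ x → M ⊑ y
  ⊑-resp x≈y M⊑x = ≤∞-trans M⊑x (≤∞-reflexive (ν.cong x≈y))

  ≤-⊑ : ∀ {K M x} → K ℚ.≤ M → M ⊑ x → K ⊑ x
  ≤-⊑ K≤M = ≤∞-trans [ K≤M ]≤

  ⊑-0 : ∀ {M x} → x ≈ 0# → M ⊑ x
  ⊑-0 x≈0 = ≤∞-trans (_ ≤⊤⁺) (≤∞-reflexive (≡.sym (ν.0⇒∞ x≈0)))

  ⊑-+ : ∀ {M x y} → M ⊑ x → M ⊑ y → M ⊑ x + y
  ⊑-+ M⊑x M⊑y = ≤∞-trans (≤∞-⊓ M⊑x M⊑y) (ν.+-min _ _)

  ⊑-* : ∀ {M K x y} → M ⊑ x → K ⊑ y → (M ℚ.+ K) ⊑ x * y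
  ⊑-* M⊑x K⊑y = ≤∞-trans (≤∞-+ M⊑x K⊑y) (≤∞-reflexive (≡.sym (ν.*-homo _ _)))

  ν-1 : ν 1# ≡ [ 0ℚ ]
  ν-1 = [x]+[x]≡[x]⇒x≡0 (λ ν1≡∞ → 1≉0 (ν.∞⇒0 ν1≡∞))
    (≡.trans (≡.sym (ν.*-homo 1# 1#)) (ν.cong (*-identityˡ 1#)))

  ⊑-1 : 0ℚ ⊑ 1#
  ⊑-1 = ≤∞-reflexive (≡.sym ν-1)

  -- Negation is multiplication by -1, and twice the valuation of -1 is that of 1, namely 0.
  ⊑-neg : ∀ {M x} → M ⊑ x → M ⊑ - x
  ⊑-neg {M} {x} M⊑x = ⊑-resp (-1*x≈-x x)
    (≤-⊑ (ℚ.≤-reflexive (≡.sym (ℚ.+-identityˡ M))) (⊑-* 0⊑-1 M⊑x))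
    where
    0⊑-1 : 0ℚ ⊑ - 1#
    0⊑-1 = u+u≡0⇒0≤u (≡.trans (≡.sym (ν.*-homo _ _))
      (≡.trans (ν.cong (trans (-1*x≈-x (- 1#)) (-‿involutive 1#))) ν-1))

  ⊑-0* : ∀ {M x y} → 0ℚ ⊑ x → M ⊑ y → M ⊑ x * y
  ⊑-0* {M} 0⊑x M⊑y = ≤-⊑ (ℚ.≤-reflexive (≡.sym (ℚ.+-identityˡ M))) (⊑-* 0⊑x M⊑y)

  ⊑-^ : ∀ {x} n → 0ℚ ⊑ x → 0ℚ ⊑ x ^ n
  ⊑-^ zero    0⊑x = ⊑-1
  ⊑-^ (suc n) 0⊑x = ⊑-0* 0⊑x (⊑-^ n 0⊑x)

  ⊑-Sum : ∀ {P : Pred A b} {M xs f} → All P xs → (∀ {x} → P x → M ⊑ f x) → M ⊑ Sum xs f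
  ⊑-Sum []         M⊑f = ⊑-0 refl
  ⊑-Sum (px ∷ pxs) M⊑f = ⊑-+ (M⊑f px) (⊑-Sum pxs M⊑f)

  lowerBound : ∀ x → ∃ λ K → K ⊑ x
  lowerBound x with ν x
  ... | ∞     = 0ℚ , (_ ≤⊤⁺)
  ... | [ v ] = v , [ ℚ.≤-refl ]≤

  unit⇒⊑ : ∀ {x} → ν x ≡ [ 0ℚ ] ⊎ ν x ≡ ∞ → 0ℚ ⊑ x
  unit⇒⊑ (inj₁ νx≡0) = ≤∞-reflexive (≡.sym νx≡0)
  unit⇒⊑ (inj₂ νx≡∞) = ⊑-0 (ν.∞⇒0 νx≡∞)

  -- `ConvergesTo L ν u x` unfolds to `Null` of the sequence `u n - x`, so lemmas on null sequences
  -- apply to convergence as they stand.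
  Bounded Null : (ℕ → Carrier) → Set
  Bounded u = ∃ λ K → ∀ n → K ⊑ u n
  Null u = ∀ M → ∃ λ N → ∀ n → N ℕ.≤ n → M ⊑ u n

  bounded-const : ∀ x → Bounded (λ _ → x)
  bounded-const x = proj₁ (lowerBound x) , λ _ → proj₂ (lowerBound x)

  null-resp : ∀ {u v} → (∀ n → u n ≈ v n) → Null u → Null v
  null-resp u≈v u-null M = proj₁ (u-null M) , λ n N≤n → ⊑-resp (u≈v n) (proj₂ (u-null M) n N≤n)

  null-+ : ∀ {u v} → Null u → Null v → Null (λ n → u n + v n)
  null-+ u-null v-null M = N₁ ℕ.⊔ N₂ , λ n N≤n →
    ⊑-+ (proj₂ (u-null M) n (ℕ.≤-trans (ℕ.m≤m⊔n N₁ N₂) N≤n)) (proj₂ (v-null M) n (ℕ.≤-trans (ℕ.m≤n⊔m N₁ N₂) N≤n))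
    where
    N₁ = proj₁ (u-null M)
    N₂ = proj₁ (v-null M)

  null-neg : ∀ {u} → Null u → Null (λ n → - u n)
  null-neg u-null M = proj₁ (u-null M) , λ n N≤n → ⊑-neg (proj₂ (u-null M) n N≤n)

  null-0 : Null (λ _ → 0#)
  null-0 M = 0 , λ _ _ → ⊑-0 refl

  null-* : ∀ {u v} → Null u → Bounded v → Null (λ n → u n * v n)
  null-* u-null (K , K⊑v) M = proj₁ (u-null (M ℚ.- K)) , λ n N≤n →
    ≤-⊑ (ℚ.≤-reflexive (≡.sym cancel)) (⊑-* (proj₂ (u-null (M ℚ.- K)) n N≤n) (K⊑v n))
    where
    cancel : (M ℚ.- K) ℚ.+ K ≡ M
    cancel = ≡.trans (ℚ.+-assoc M (ℚ.- K) K) (≡.trans (≡.cong (M ℚ.+_) (ℚ.+-inverseˡ K)) (ℚ.+-identityʳ M))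

  null⇒bounded : ∀ {u} → Null u → Bounded u
  null⇒bounded {u} u-null = K , K⊑u
    where
    N = proj₁ (u-null 0ℚ)
    initial : ∀ N → ∃ λ K → ∀ n → n < N → K ⊑ u n
    initial zero    = 0ℚ , λ _ ()
    initial (suc N) with initial N | lowerBound (u N)
    ... | K , K⊑u | K′ , K′⊑u = K ℚ.⊓ K′ , bound
      where
      bound : ∀ n → n < suc N → (K ℚ.⊓ K′) ⊑ u n
      bound n (ℕ.s≤s n≤N) with ℕ.m≤n⇒m<n∨m≡n n≤N
      ... | inj₁ n<N    = ≤-⊑ (ℚ.p⊓q≤p K K′) (K⊑u n n<N)
      ... | inj₂ ≡.refl = ≤-⊑ (ℚ.p⊓q≤q K K′) K′⊑u
    K₀ = proj₁ (initial N)
    K = K₀ ℚ.⊓ 0ℚ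
    K⊑u : ∀ n → K ⊑ u n
    K⊑u n with ℕ.<-≤-connex n N
    ... | inj₁ n<N = ≤-⊑ (ℚ.p⊓q≤p K₀ 0ℚ) (proj₂ (initial N) n n<N)
    ... | inj₂ N≤n = ≤-⊑ (ℚ.p⊓q≤q K₀ 0ℚ) (proj₂ (u-null 0ℚ) n N≤n)

  converges⇒bounded : ∀ {u x} → ConvergesTo L ν u x → Bounded u
  converges⇒bounded {u} {x} u→x with null⇒bounded u→x | lowerBound x
  ... | K , K⊑u-x | K′ , K′⊑x = K ℚ.⊓ K′ , λ n → ⊑-resp
    (trans (+-assoc _ _ _) (trans (+-congˡ (-‿inverseˡ x)) (+-identityʳ _)))
    (⊑-+ (≤-⊑ (ℚ.p⊓q≤p K K′) (K⊑u-x n)) (≤-⊑ (ℚ.p⊓q≤q K K′) K′⊑x))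

  -- By the ultrametric inequality a block of consecutive terms is as small as its largest term, so
  -- null terms make the partial sums Cauchy.
  null⇒below-converges : IsComplete L ν → ∀ {u} → Null u → ∃ λ l → ConvergesTo L ν (λ D → below D u) l
  null⇒below-converges complete {u} u-null = complete _ cauchy
    where
    tail : ∀ {M N} → (∀ n → N ℕ.≤ n → M ⊑ u n) → ∀ k → M ⊑ below (k ℕ.+ N) u - below N u
    tail         M⊑u zero    = ⊑-0 (-‿inverseʳ _)
    tail {N = N} M⊑u (suc k) = ⊑-resp
      (begin
        (below (k ℕ.+ N) u - below N u) + u (k ℕ.+ N)      ≈⟨ +-assoc _ _ _ ⟩
        below (k ℕ.+ N) u + (- below N u + u (k ℕ.+ N))    ≈⟨ +-congˡ (+-comm _ _) ⟩
        below (k ℕ.+ N) u + (u (k ℕ.+ N) - below N u)      ≈⟨ +-assoc _ _ _ ⟨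
        (below (k ℕ.+ N) u + u (k ℕ.+ N)) - below N u      ≈⟨ +-congʳ (below-last (k ℕ.+ N) u) ⟨
        below (suc k ℕ.+ N) u - below N u                  ∎)
      (⊑-+ (tail M⊑u k) (M⊑u (k ℕ.+ N) (ℕ.m≤n+m N k)))
    cauchy : IsCauchy L ν (λ D → below D u)
    cauchy M = N , λ m n N≤m N≤n → ⊑-resp
      (begin
        (below m u - below N u) - (below n u - below N u)        ≈⟨ -‿+-interchange _ _ _ _ ⟩
        (below m u - below n u) + (- below N u - - below N u)    ≈⟨ +-congˡ (-‿inverseʳ _) ⟩
        (below m u - below n u) + 0#                             ≈⟨ +-identityʳ _ ⟩
        below m u - below n u                                    ∎)
      (⊑-+ (close m N≤m) (⊑-neg (close n N≤n)))
      where
      N = proj₁ (u-null M)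
      close : ∀ n → N ℕ.≤ n → M ⊑ below n u - below N u
      close n N≤n = ≡.subst (λ n → M ⊑ below n u - below N u) (ℕ.m∸n+n≡m N≤n) (tail (proj₂ (u-null M)) (n ℕ.∸ N))

  converges-resp : ∀ {u v x} → (∀ n → u n ≈ v n) → ConvergesTo L ν u x → ConvergesTo L ν v x
  converges-resp u≈v = null-resp (λ n → +-congʳ (u≈v n))

  converges-0 : ConvergesTo L ν (λ _ → 0#) 0#
  converges-0 = null-resp (λ _ → sym (-‿inverseʳ 0#)) null-0

  converges-+ : ∀ {u v x y} → ConvergesTo L ν u x → ConvergesTo L ν v y → ConvergesTo L ν (λ n → u n + v n) (x + y)
  converges-+ u→x v→y = null-resp (λ n → sym (-‿+-interchange _ _ _ _)) (null-+ u→x v→y)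

  converges-neg : ∀ {u x} → ConvergesTo L ν u x → ConvergesTo L ν (λ n → - u n) (- x)
  converges-neg u→x = null-resp (λ n → sym (-‿+-comm _ _)) (null-neg u→x)

  converges-* : ∀ {u v x y} → ConvergesTo L ν u x → ConvergesTo L ν v y → ConvergesTo L ν (λ n → u n * v n) (x * y)
  converges-* {u} {v} {x} {y} u→x v→y = null-resp split
    (null-+ (null-+ (null-* u→x (null⇒bounded v→y)) (null-* u→x (bounded-const y))) (null-* v→y (bounded-const x)))
    where
    split : ∀ n → ((u n - x) * (v n - y) + (u n - x) * y) + (v n - y) * x ≈ u n * v n - x * y
    split n = begin
      ((u n - x) * (v n - y) + (u n - x) * y) + (v n - y) * x
        ≈⟨ +-cong (sym (distribˡ _ _ _)) (trans (*-comm _ _) (*-distribˡ-minus _ _ _)) ⟩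
      (u n - x) * ((v n - y) + y) + (x * v n - x * y)
        ≈⟨ +-congʳ (*-congˡ (trans (+-assoc _ _ _) (trans (+-congˡ (-‿inverseˡ y)) (+-identityʳ _)))) ⟩
      (u n - x) * v n + (x * v n - x * y)
        ≈⟨ +-assoc _ _ _ ⟨
      ((u n - x) * v n + x * v n) - x * y
        ≈⟨ +-congʳ (trans (sym (distribʳ _ _ _)) (*-congʳ (trans (+-assoc _ _ _) (trans (+-congˡ (-‿inverseˡ x)) (+-identityʳ _))))) ⟩
      u n * v n - x * y ∎

  -- The difference of two limits has valuation above every rational number, hence `∞`; a finite
  -- value `v` is refuted by the bound `v + 1`.
  converges-unique : ∀ {u x y} → ConvergesTo L ν u x → ConvergesTo L ν u y → x ≈ y
  converges-unique {u} {x} {y} u→x u→y = x-y≈0⇒x≈y x y (unbounded (λ M → ≡.subst ([ M ] ≤∞_) (ν.cong (eq M)) (close M)))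
    where
    n : ℚ → ℕ
    n M = proj₁ (u→x M) ℕ.⊔ proj₁ (u→y M)
    close : ∀ M → M ⊑ - (u (n M) - x) + (u (n M) - y)
    close M = ⊑-+ (⊑-neg (proj₂ (u→x M) (n M) (ℕ.m≤m⊔n _ _))) (proj₂ (u→y M) (n M) (ℕ.m≤n⊔m _ _))
    eq : ∀ M → - (u (n M) - x) + (u (n M) - y) ≈ x - y
    eq M = begin
      - (u (n M) - x) + (u (n M) - y)     ≈⟨ +-congʳ (-‿swap _ _) ⟩
      (x - u (n M)) + (u (n M) - y)       ≈⟨ +-assoc _ _ _ ⟩
      x + (- u (n M) + (u (n M) - y))     ≈⟨ +-congˡ (trans (sym (+-assoc _ _ _)) (trans (+-congʳ (-‿inverseˡ _)) (+-identityˡ _))) ⟩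
      x - y                               ∎
    unbounded : ∀ {z} → (∀ M → M ⊑ z) → z ≈ 0#
    unbounded {z} M⊑z with ν z in νz
    ... | ∞     = ν.∞⇒0 νz
    ... | [ v ] with M⊑z (v ℚ.+ ℚ.1ℚ)
    ...   | [ v+1≤v ]≤ = contradiction (ℚ.<-≤-trans v<v+1 v+1≤v) (ℚ.<-irrefl ≡.refl)
      where
      v<v+1 : v ℚ.< v ℚ.+ ℚ.1ℚ
      v<v+1 = ≡.subst (ℚ._< v ℚ.+ ℚ.1ℚ) (ℚ.+-identityʳ v) (ℚ.+-monoʳ-< v (ℚ.positive⁻¹ ℚ.1ℚ))

module QuasiShuffle {c ℓ c′ ℓ′ : Level}
  (p e q : ℕ) (p-prime : Prime p) (q≡p^e : q ≡ p ℕ.^ e)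
  (F : Field c ℓ) (card : HasCardinality q F)
  (L : Field c′ ℓ′) (ι : Field.Carrier F → Field.Carrier L) (ι-homomorphism : IsFieldHomomorphism F L ι)
  (ν : Field.Carrier L → ℚ∞) (isValuation : IsValuation L ν) (isComplete : IsComplete L ν)
  (I : List ℕ) (I-unique : Unique I)
  (δ : ℕ → Polynomial.Poly F → Field.Carrier L)
  (γ : Polynomial.Poly F → Field.Carrier L)
  (δ-linear : ∀ {i} → i ∈ˡ I → IsInjectiveLinear F L ι (δ i))
  (γ-linear : IsInjectiveLinear F L ι γ)
  (δ-unit : ∀ {i} → i ∈ˡ I → ∀ a → ν (δ i a) ≡ [ 0ℚ ] ⊎ ν (δ i a) ≡ ∞)
  (γ-tends : InverseTendsToZero F L ν γ)
  where
  open Field L hiding (zero)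
  open FieldLemmas L
  open PolynomialSums F card L
  open ValuationLemmas L ν isValuation
  open MultipleSums p F card L ν I δ γ
  open Polynomial F
  open SetoidReasoning setoid
  open ExpProperties semiring using (^-congˡ; ^-homo-*)
  open CommutativeExp commutativeSemiring using (^-distrib-*)
  open MultProperties semiring using (×1-homo-*)
  open CommutativeSemigroupProperties *-commutativeSemigroup using (interchange)
  open NaturalSolver commutativeSemiring using (solve; _:=_; _:*_; con)
  private
    module F = Field F
    module ℕ+ = CommutativeSemigroupProperties ℕ.+-commutativeSemigroup
    open Inverse card using (to; from; strictlyInverseˡ)
    module ι = RingMorphisms.IsRingHomomorphism ι-homomorphism

  -- Characteristic `p` and the prime field

  ι-nonzero : ∀ {x} → ¬ x F.≈ F.0# → ¬ ι x ≈ 0#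
  ι-nonzero {x} x≉0 ιx≈0 = 1≉0 (begin
    1#                    ≈⟨ ι.1#-homo ⟨
    ι F.1#                ≈⟨ ι.⟦⟧-cong (F.⁻¹-inverse x≉0) ⟨
    ι (x F.⁻¹ F.* x)      ≈⟨ ι.*-homo _ _ ⟩
    ι (x F.⁻¹) * ι x      ≈⟨ *-congˡ ιx≈0 ⟩
    ι (x F.⁻¹) * 0#       ≈⟨ zeroʳ _ ⟩
    0#                    ∎)

  -- Translation by 1 permutes the elements of F.
  Sum-1≈0 : Sum elements (λ _ → 1#) ≈ 0#
  Sum-1≈0 = x+y≈x⇒y≈0 (Sum elements ι) _ (begin
    Sum elements ι + Sum elements (λ _ → 1#)      ≈⟨ +-comm _ _ ⟩
    Sum elements (λ _ → 1#) + Sum elements ι      ≈⟨ Sum-+ elements _ _ ⟨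
    Sum elements (λ x → 1# + ι x)
      ≈⟨ Sum-cong elements (λ x → trans (ι.+-homo _ _) (+-congʳ ι.1#-homo)) ⟨
    Sum elements (λ x → ι (F.1# F.+ x))           ≈⟨ elements-shift F.1# ι.⟦⟧-cong ⟩
    Sum elements ι                                ∎)

  -- The sum in `Sum-1≈0` has `q` terms, so it equals the `e`-th power of `p · 1#`, and powers of
  -- nonzero elements are nonzero.
  p·1≈0 : p · 1# ≈ 0#
  p·1≈0 with (p · 1#) ≟0
  ... | inj₁ p·1≈0 = p·1≈0
  ... | inj₂ p·1≉0 = contradiction (begin
    (p · 1#) ^ e               ≈⟨ power e ⟨
    (p ℕ.^ e) · 1#             ≡⟨ ≡.cong (_· 1#) (≡.trans (≡.sym q≡p^e) (≡.sym (List.length-tabulate to))) ⟩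
    List.length elements · 1#  ≈⟨ Sum-1 elements ⟨
    Sum elements (λ _ → 1#)    ≈⟨ Sum-1≈0 ⟩
    0#                         ∎) (^-nonzero e p·1≉0)
    where
    power : ∀ e → (p ℕ.^ e) · 1# ≈ (p · 1#) ^ e
    power zero    = +-identityʳ 1#
    power (suc e) = trans (×1-homo-* p (p ℕ.^ e)) (*-congˡ (power e))

  ·1-∈ : ∀ {n} → n < p → (n · 1#) ∈ 𝔽ₚ
  ·1-∈ n<p = Fin.fromℕ< n<p , reflexive (≡.cong (_· 1#) (≡.sym (Fin.toℕ-fromℕ< n<p)))

  1-∈ : 1# ∈ 𝔽ₚ
  1-∈ with ·1-∈ (ℕ.nonTrivial⇒n>1 p {{prime⇒nonTrivial p-prime}})
  ... | k , 1≈k = k , trans (sym (+-identityʳ 1#)) 1≈k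

  -- The representative is `p - 1`. Signs are thus scalars of `𝔽ₚ`, and the integer combinations of
  -- `AddSpan` turn into members of `Span`.
  -1-∈ : (- 1#) ∈ 𝔽ₚ
  -1-∈ with ·1-∈ (ℕ.≤-reflexive (ℕ.suc-pred p {{prime⇒nonZero p-prime}}))
  ... | k , p-1≈k = k , trans (sym (x+y≈0⇒y≈-x 1# _
    (trans (reflexive (≡.cong (_· 1#) (ℕ.suc-pred p {{prime⇒nonZero p-prime}}))) p·1≈0))) p-1≈k

  Span-neg : ∀ {G : Pred Carrier g} {x} → x ∈ Span G → (- x) ∈ Span G
  Span-neg x∈ = resp-∈ (-1*x≈-x _) (scale-∈ -1-∈ x∈)

  Span-* : ∀ {G H : Pred Carrier g} {K : Pred Carrier h} →
           (∀ {x y} → x ∈ G → y ∈ H → (x * y) ∈ Span K) →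
           ∀ {x y} → x ∈ Span G → y ∈ Span H → (x * y) ∈ Span K
  Span-* {G = G} {H} {K} GH = left
    where
    right : ∀ {x y} → x ∈ G → y ∈ Span H → (x * y) ∈ Span K
    right x∈ (gen-∈ y∈)         = GH x∈ y∈
    right x∈ 0-∈                = resp-∈ (sym (zeroʳ _)) 0-∈
    right x∈ (+-∈ y∈ z∈)        = resp-∈ (sym (distribˡ _ _ _)) (+-∈ (right x∈ y∈) (right x∈ z∈))
    right x∈ (scale-∈ {k} {y} k∈ y∈) = resp-∈
      (solve 3 (λ k x y → k :* (x :* y) := x :* (k :* y)) refl k _ y) (scale-∈ k∈ (right x∈ y∈))
    right x∈ (resp-∈ y≈z y∈)    = resp-∈ (*-congˡ y≈z) (right x∈ y∈)
    left : ∀ {x y} → x ∈ Span G → y ∈ Span H → (x * y) ∈ Span K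
    left (gen-∈ x∈)       y∈ = right x∈ y∈
    left 0-∈              y∈ = resp-∈ (sym (zeroˡ _)) 0-∈
    left (+-∈ x∈ z∈)      y∈ = resp-∈ (sym (distribʳ _ _ _)) (+-∈ (left x∈ y∈) (left z∈ y∈))
    left (scale-∈ k∈ x∈)  y∈ = resp-∈ (sym (*-assoc _ _ _)) (scale-∈ k∈ (left x∈ y∈))
    left (resp-∈ x≈z x∈)  y∈ = resp-∈ (*-congʳ x≈z) (left x∈ y∈)

  -- Semi-characters: boundedness, homogeneity, expansion at a sum

  𝟏-semiCharacter : IsSemiCharacter 𝟏
  𝟏-semiCharacter = (λ _ → 0) , λ a → sym (ones I a)
    where
    ones : ∀ J a → ∏ (map (λ i → δ i a ^ 0) J) ≈ 1#
    ones []      a = refl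
    ones (i ∷ J) a = trans (*-identityˡ _) (ones J a)

  ⊗-semiCharacter : ∀ {σ ψ} → IsSemiCharacter σ → IsSemiCharacter ψ → IsSemiCharacter (σ ⊗ ψ)
  ⊗-semiCharacter (α , σ≗) (β , ψ≗) = (λ i → α i ℕ.+ β i) , λ a → trans (*-cong (σ≗ a) (ψ≗ a)) (merge I a)
    where
    merge : ∀ J a → ∏ (map (λ i → δ i a ^ α i) J) * ∏ (map (λ i → δ i a ^ β i) J) ≈ ∏ (map (λ i → δ i a ^ (α i ℕ.+ β i)) J)
    merge []      a = *-identityˡ 1#
    merge (i ∷ J) a = trans
      (interchange _ _ _ _)
      (*-cong (sym (^-homo-* (δ i a) (α i) (β i))) (merge J a))

  -- The exponents are the indicator function of `i`; uniqueness of the entries of `I` ensures that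
  -- `δ i` is taken only once.
  δ-semiCharacter : ∀ {i} → i ∈ˡ I → IsSemiCharacter (δ i)
  δ-semiCharacter {i} i∈I = α , λ a → sym (single I-unique i∈I a)
    where
    α : ℕ → ℕ
    α j with i ℕ.≟ j
    ... | yes _ = 1
    ... | no  _ = 0
    α-≢ : ∀ {j} a → ¬ i ≡ j → δ j a ^ α j ≈ 1#
    α-≢ {j} a i≢j with i ℕ.≟ j
    ... | yes i≡j = contradiction i≡j i≢j
    ... | no  _   = refl
    α-≡ : ∀ a → δ i a ^ α i ≈ δ i a
    α-≡ a with i ℕ.≟ i
    ... | yes _   = *-identityʳ _
    ... | no  i≢i = contradiction ≡.refl i≢i
    none : ∀ {J} → All (λ j → ¬ i ≡ j) J → ∀ a → ∏ (map (λ j → δ j a ^ α j) J) ≈ 1#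
    none []           a = refl
    none (i≢j ∷ i∉J)  a = trans (*-cong (α-≢ a i≢j) (none i∉J a)) (*-identityˡ 1#)
    single : ∀ {J} → Unique J → i ∈ˡ J → ∀ a → ∏ (map (λ j → δ j a ^ α j) J) ≈ δ i a
    single (i∉J ∷ _)  (here ≡.refl) a = trans (*-cong (α-≡ a) (none i∉J a)) (*-identityʳ _)
    single (j∉J ∷ uJ) (there i∈J)   a = trans
      (*-cong (α-≢ a (λ i≡j → All.lookup j∉J i∈J (≡.sym i≡j))) (single uJ i∈J a)) (*-identityˡ _)

  -- The properties wanted of semi-characters are stable under products, and for a single `δ i` they
  -- come from linearity or from its valuations.
  semiCharacter-induction : (P : Pred (Poly → Carrier) g) →
    (∀ {σ ψ} → σ ≗ ψ → P σ → P ψ) → P 𝟏 → (∀ {σ ψ} → P σ → P ψ → P (σ ⊗ ψ)) → (∀ {i} → i ∈ˡ I → P (δ i)) →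
    ∀ {σ} → IsSemiCharacter σ → P σ
  semiCharacter-induction P P-resp P-𝟏 P-⊗ P-δ (α , σ≗) = P-resp (λ a → sym (σ≗ a)) (products I (λ i∈I → i∈I))
    where
    powers : ∀ {i} → i ∈ˡ I → ∀ n → P (λ a → δ i a ^ n)
    powers i∈I zero    = P-𝟏
    powers i∈I (suc n) = P-⊗ (P-δ i∈I) (powers i∈I n)
    products : ∀ J → (∀ {i} → i ∈ˡ J → i ∈ˡ I) → P (λ a → ∏ (map (λ i → δ i a ^ α i) J))
    products []      J⊆I = P-𝟏
    products (i ∷ J) J⊆I = P-⊗ (powers (J⊆I (here ≡.refl)) (α i)) (products J (λ i∈J → J⊆I (there i∈J)))

  private
    module Linear {φ : Poly → Carrier} (φ-linear : IsInjectiveLinear F L ι φ) where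
      open LeftModuleMorphisms.IsLeftModuleMonomorphism φ-linear public
        using (⟦⟧-cong; +ᴹ-homo; *ₗ-homo; 0ᴹ-homo; injective)
    module γ = Linear γ-linear

  semiCharacter-cong : ∀ {σ} → IsSemiCharacter σ → CongruentA σ
  semiCharacter-cong = semiCharacter-induction CongruentA
    (λ σ≗ψ σ-cong a≈b → trans (sym (σ≗ψ _)) (trans (σ-cong a≈b) (σ≗ψ _)))
    (λ _ → refl)
    (λ σ-cong ψ-cong a≈b → *-cong (σ-cong a≈b) (ψ-cong a≈b))
    (λ i∈I → Linear.⟦⟧-cong (δ-linear i∈I))

  semiCharacter-⊑ : ∀ {σ} → IsSemiCharacter σ → ∀ a → 0ℚ ⊑ σ a
  semiCharacter-⊑ = semiCharacter-induction (λ σ → ∀ a → 0ℚ ⊑ σ a)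
    (λ σ≗ψ 0⊑σ a → ⊑-resp (σ≗ψ a) (0⊑σ a))
    (λ _ → ⊑-1)
    (λ 0⊑σ 0⊑ψ a → ⊑-0* (0⊑σ a) (0⊑ψ a))
    (λ i∈I a → unit⇒⊑ (δ-unit i∈I a))

  -- Each linear factor contributes one `ι x`, so `h` counts the factors with multiplicity.
  semiCharacter-homogeneous : ∀ {σ} → IsSemiCharacter σ → ∃ λ h → ∀ x a → σ (x • a) ≈ ι x ^ h * σ a
  semiCharacter-homogeneous = semiCharacter-induction (λ σ → ∃ λ h → ∀ x a → σ (x • a) ≈ ι x ^ h * σ a)
    (λ σ≗ψ (h , σ-hom) → h , λ x a → trans (sym (σ≗ψ _)) (trans (σ-hom x a) (*-congˡ (σ≗ψ a))))
    (0 , λ x a → sym (*-identityˡ 1#))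
    (λ {σ} {ψ} (h , σ-hom) (k , ψ-hom) → h ℕ.+ k , λ x a → begin
      σ (x • a) * ψ (x • a)                     ≈⟨ *-cong (σ-hom x a) (ψ-hom x a) ⟩
      (ι x ^ h * σ a) * (ι x ^ k * ψ a)         ≈⟨ interchange _ _ _ _ ⟩
      (ι x ^ h * ι x ^ k) * (σ a * ψ a)         ≈⟨ *-congʳ (^-homo-* (ι x) h k) ⟨
      ι x ^ (h ℕ.+ k) * (σ a * ψ a)             ∎)
    (λ i∈I → 1 , λ x a → trans (Linear.*ₗ-homo (δ-linear i∈I) x a) (*-congʳ (sym (*-identityʳ (ι x)))))

  -- One term in the expansion of `χ` at a sum: the two variables separate, and `ρ⊗τ≗χ` records that
  -- every linear factor went to one of them, so the total character is kept.
  record Split (χ : Poly → Carrier) (f : Poly × Poly → Carrier) : Set (c ⊔ c′ ⊔ ℓ′) where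
    constructor split
    field
      {ρ τ} : Poly → Carrier
      ρ-semiCharacter : IsSemiCharacter ρ
      τ-semiCharacter : IsSemiCharacter τ
      ρ⊗τ≗χ : (ρ ⊗ τ) ≗ χ
      f≗ : ∀ x → f x ≈ ρ (proj₁ x) * τ (proj₂ x)

  -- By multiplying out the linear factors.
  semiCharacter-split : ∀ {σ} → IsSemiCharacter σ → (λ x → σ (proj₁ x +ᴬ proj₂ x)) ∈ AddSpan (Split σ)
  semiCharacter-split = semiCharacter-induction (λ σ → (λ x → σ (proj₁ x +ᴬ proj₂ x)) ∈ AddSpan (Split σ))
    (λ σ≗ψ σ∈ → resp-∈ (λ _ → σ≗ψ _) (AddSpan-⊆
      (λ (split ρ τ ρτ≗σ f≗) → split ρ τ (λ a → trans (ρτ≗σ a) (σ≗ψ a)) f≗) σ∈))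
    (gen-∈ (split 𝟏-semiCharacter 𝟏-semiCharacter (λ _ → *-identityˡ 1#) (λ _ → sym (*-identityˡ 1#))))
    (AddSpan-* λ (split ρ τ ρτ≗σ f≗) (split ρ′ τ′ ρτ′≗ψ f′≗) → gen-∈ (split
      (⊗-semiCharacter ρ ρ′) (⊗-semiCharacter τ τ′)
      (λ a → trans (interchange _ _ _ _) (*-cong (ρτ≗σ a) (ρτ′≗ψ a)))
      (λ x → trans (*-cong (f≗ x) (f′≗ x)) (interchange _ _ _ _))))
    (λ i∈I → resp-∈ (λ x → sym (Linear.+ᴹ-homo (δ-linear i∈I) (proj₁ x) (proj₂ x))) (+-∈
      (gen-∈ (split (δ-semiCharacter i∈I) 𝟏-semiCharacter (λ _ → *-identityʳ _) (λ _ → sym (*-identityʳ _))))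
      (gen-∈ (split 𝟏-semiCharacter (δ-semiCharacter i∈I) (λ _ → *-identityˡ _) (λ _ → sym (*-identityˡ _))))))

  -- Character sums over the nonzero elements of `F`

  Sum*-1 : Sum* (λ _ → 1#) ≈ - 1#
  Sum*-1 = trans (+-congʳ Sum-1≈0) (+-identityˡ _)

  -- A nontrivial character of F ∖ {0} sums to 0, as multiplication by x
  -- permutes F ∖ {0}; the trivial one sums to q - 1.
  Sum*-character : ∀ {u} → CongruentF u → (∀ {x y} → ¬ x F.≈ F.0# → ¬ y F.≈ F.0# → u (x F.* y) ≈ u x * u y) →
                   Sum* u ≈ 0# ⊎ Sum* u ≈ - 1#
  Sum*-character {u} u-cong u-homo with All.decide test elements
    where
    test : ∀ x → (¬ x F.≈ F.0# → u x ≈ 1#) ⊎ (¬ x F.≈ F.0# × ¬ u x - 1# ≈ 0#)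
    -- An `x` that is zero satisfies the first alternative vacuously; only a nonzero `x` can be a
    -- witness of nontriviality.
    test x with ι x ≟0 | (u x - 1#) ≟0
    ... | inj₁ ιx≈0 | _         = inj₁ (λ x≉0 → contradiction ιx≈0 (ι-nonzero x≉0))
    ... | inj₂ ιx≉0 | inj₁ ux≈1 = inj₁ (λ _ → x-y≈0⇒x≈y _ _ ux≈1)
    ... | inj₂ ιx≉0 | inj₂ ux≉1 = inj₂ ((λ x≈0 → ιx≉0 (trans (ι.⟦⟧-cong x≈0) ι.0#-homo)) , ux≉1)
  ... | inj₁ u≈1 = inj₂ (trans (Sum*-cong u-cong (λ _ → refl) u≈1′) Sum*-1)
    where
    u≈1′ : ∀ x → ¬ x F.≈ F.0# → u x ≈ 1#
    u≈1′ x x≉0 = trans (u-cong (F.sym (strictlyInverseˡ x)))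
      (All.tabulate⁻ u≈1 (from x) (λ tx≈0 → x≉0 (F.trans (F.sym (strictlyInverseˡ x)) tx≈0)))
  ... | inj₂ u≉1 with Any.satisfied u≉1
  ...   | x , x≉0 , ux≉1 = inj₁ (*-cancel-nonzero ux≉1 (begin
    (u x - 1#) * Sum* u         ≈⟨ *-distribʳ-minus _ _ _ ⟩
    u x * Sum* u - 1# * Sum* u  ≈⟨ x-x≈0 (begin
      u x * Sum* u              ≈⟨ Sum*-*ˡ (u x) u ⟨
      Sum* (λ y → u x * u y)    ≈⟨ Sum*-cong (λ y≈z → u-cong (F.*-congˡ y≈z)) (λ y≈z → *-congˡ (u-cong y≈z)) (λ y y≉0 → u-homo x≉0 y≉0) ⟨
      Sum* (λ y → u (x F.* y))  ≈⟨ Sum*-scale x≉0 u-cong ⟩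
      Sum* u                    ≈⟨ *-identityˡ _ ⟨
      1# * Sum* u               ∎) ⟩
    0#                          ∎))

  -- Power sums and pairs of distinct monic polynomials

  X : Poly → Carrier
  X a = γ a ⁻¹

  X-cong : CongruentA X
  X-cong a≈b = ⁻¹-cong (γ.⟦⟧-cong a≈b)

  γ-nonzero : ∀ {d a} → Monic d a → ¬ γ a ≈ 0#
  γ-nonzero a-monic γa≈0 = Monic⇒≉0 a-monic (γ.injective (trans γa≈0 (sym γ.0ᴹ-homo)))

  PowerSum : (Poly → Carrier) → ℕ → ℕ → Carrier
  PowerSum σ n d = Monics d (λ a → σ a * X a ^ n)

  MonicPairs : ℕ → (Poly × Poly → Carrier) → Carrier
  MonicPairs d f = Monics d (λ a → Monics d (λ b → f (a , b)))

  -- The sum over the pairs of distinct monic polynomials of degree d.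
  DistinctPairs : ℕ → (Poly × Poly → Carrier) → Carrier
  DistinctPairs d f = MonicPairs d f - Monics d (λ a → f (a , a))

  DistinctPairs-isAdditive : ∀ d → IsAdditive (DistinctPairs d)
  DistinctPairs-isAdditive d = minus-additive
    (Sum-additive (monics card d) (λ a → Sum-additive (monics card d) (λ b → eval-additive (a , b))))
    (Sum-additive (monics card d) (λ a → eval-additive (a , a)))

  DistinctPairs-swap : ∀ d f → DistinctPairs d f ≈ DistinctPairs d (λ x → f (proj₂ x , proj₁ x))
  DistinctPairs-swap d f = +-congʳ (Sum-swap (monics card d) (monics card d) (λ a b → f (a , b)))

  Congruent₂ : (Poly × Poly → Carrier) → Set _
  Congruent₂ f = ∀ {a a′ b b′} → a ≈ᴬ a′ → b ≈ᴬ b′ → f (a , b) ≈ f (a′ , b′)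

  -- This is the substitution `b = a + x c`. For fixed `a` the differences `b - a` are all
  -- polynomials of degree below `d`, and the zero difference is the subtracted diagonal term.
  DistinctPairs-difference : ∀ d {f} → Congruent₂ f →
    DistinctPairs d f ≈ Monics d (λ a → Sum* (λ x → MonicsBelow d (λ c → f (a , a +ᴬ x • c))))
  DistinctPairs-difference d {f} f-cong = begin
    MonicPairs d f - Monics d (λ a → f (a , a))
      ≈⟨ IsAdditive.homo-minus (Sum-isAdditive (monics card d)) _ _ ⟨
    Monics d (λ a → Monics d (λ b → f (a , b)) - f (a , a))
      ≈⟨ Sum-congᴬ (monics-Monic d) (λ {a} a-monic → begin
        Monics d (λ b → f (a , b)) - f (a , a)
          ≈⟨ +-cong (Monics-translate a-monic (f-cong (≈ᴬ-refl a))) (-‿cong (f-cong (≈ᴬ-refl a) (+ᴬ-identityʳ a))) ⟩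
        Smaller d (λ b → f (a , a +ᴬ b)) - f (a , a +ᴬ [])
          ≈⟨ +-congʳ (Smaller-monic d (λ b≈c → f-cong (≈ᴬ-refl a) (+ᴬ-congˡ a b≈c))) ⟩
        (f (a , a +ᴬ []) + Sum* (λ x → MonicsBelow d (λ c → f (a , a +ᴬ x • c)))) - f (a , a +ᴬ [])
          ≈⟨ x+y-x≈y _ _ ⟩
        Sum* (λ x → MonicsBelow d (λ c → f (a , a +ᴬ x • c))) ∎) ⟩
    Monics d (λ a → Sum* (λ x → MonicsBelow d (λ c → f (a , a +ᴬ x • c)))) ∎

  γ-difference : ∀ a x c → γ (a +ᴬ x • c) - γ a ≈ γ (x • c)
  γ-difference a x c = trans (+-congʳ (γ.+ᴹ-homo a (x • c))) (x+y-x≈y _ _)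

  γ-•-nonzero : ∀ {x e c} → ¬ x F.≈ F.0# → Monic e c → ¬ γ (x • c) ≈ 0#
  γ-•-nonzero {x} {e} {c} x≉0 c-monic γxc≈0 =
    *-nonzero (ι-nonzero x≉0) (γ-nonzero c-monic) (trans (sym (γ.*ₗ-homo x c)) γxc≈0)

  MonicsBelow-cong : ∀ d {f g} → (∀ {e c} → e < d → Monic e c → f c ≈ g c) → MonicsBelow d f ≈ MonicsBelow d g
  MonicsBelow-cong d f≈g = Sum-congᴬ (All.all-upTo d) (λ e<d → Sum-congᴬ (monics-Monic _) (f≈g e<d))

  -- After the substitution `b = a + x c` only nonzero differences remain, and injectivity of `γ`
  -- makes γ(b) - γ(a) invertible there. Identities that involve its inverse can then be used
  -- termwise.
  DistinctPairs-cong : ∀ d {f g} → Congruent₂ f → Congruent₂ g →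
    (∀ {a b} → Monic d a → Monic d b → ¬ γ b - γ a ≈ 0# → f (a , b) ≈ g (a , b)) →
    DistinctPairs d f ≈ DistinctPairs d g
  DistinctPairs-cong d {f} {g} f-cong g-cong f≈g = begin
    DistinctPairs d f
      ≈⟨ DistinctPairs-difference d f-cong ⟩
    Monics d (λ a → Sum* (λ x → MonicsBelow d (λ c → f (a , a +ᴬ x • c))))
      ≈⟨ Sum-congᴬ (monics-Monic d) (λ {a} a-monic → Sum*-cong (inner-cong f f-cong a) (inner-cong g g-cong a) (λ x x≉0 →
           MonicsBelow-cong d (λ {_} {c} e<d c-monic → f≈g a-monic (Monic-+ a-monic c-monic e<d x)
             (λ eq → γ-•-nonzero x≉0 c-monic (trans (sym (γ-difference a x c)) eq))))) ⟩
    Monics d (λ a → Sum* (λ x → MonicsBelow d (λ c → g (a , a +ᴬ x • c))))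
      ≈⟨ DistinctPairs-difference d g-cong ⟨
    DistinctPairs d g ∎
    where
    inner-cong : ∀ f → Congruent₂ f → ∀ a → CongruentF (λ x → MonicsBelow d (λ c → f (a , a +ᴬ x • c)))
    inner-cong f f-cong a x≈y = IsAdditive.cong (MonicsBelow-isAdditive d)
      (λ c → f-cong (≈ᴬ-refl a) (+ᴬ-congˡ a (•-congʳ x≈y c)))

  Z : Poly × Poly → Carrier
  Z x = (γ (proj₂ x) - γ (proj₁ x)) ⁻¹

  -- Partial fractions preserve the weight `n + m + j`. On the diagonal `Z` inverts zero; that
  -- unspecified value cancels in `DistinctPairs`.
  PairTerm : (σ ψ : Poly → Carrier) (n m j : ℕ) → Poly × Poly → Carrier
  PairTerm σ ψ n m j x = (σ (proj₁ x) * ψ (proj₂ x)) * (X (proj₁ x) ^ n * X (proj₂ x) ^ m * Z x ^ j)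

  PairTerm-cong : ∀ {σ ψ} → IsSemiCharacter σ → IsSemiCharacter ψ → ∀ n m j → Congruent₂ (PairTerm σ ψ n m j)
  PairTerm-cong σ ψ n m j a≈a′ b≈b′ = *-cong
    (*-cong (semiCharacter-cong σ a≈a′) (semiCharacter-cong ψ b≈b′))
    (*-cong (*-cong (^-congˡ n (X-cong a≈a′)) (^-congˡ m (X-cong b≈b′)))
            (^-congˡ j (⁻¹-cong (+-cong (γ.⟦⟧-cong b≈b′) (-‿cong (γ.⟦⟧-cong a≈a′))))))

  partialFractions : ∀ {x y} → ¬ x ≈ 0# → ¬ y ≈ 0# → ¬ y - x ≈ 0# →
                     x ⁻¹ * y ⁻¹ ≈ (y - x) ⁻¹ * x ⁻¹ - (y - x) ⁻¹ * y ⁻¹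
  partialFractions {x} {y} x≉0 y≉0 y-x≉0 = begin
    x ⁻¹ * y ⁻¹                                       ≈⟨ *-identityˡ _ ⟨
    1# * (x ⁻¹ * y ⁻¹)                                ≈⟨ *-congʳ (⁻¹-inverse y-x≉0) ⟨
    ((y - x) ⁻¹ * (y - x)) * (x ⁻¹ * y ⁻¹)            ≈⟨ *-assoc _ _ _ ⟩
    (y - x) ⁻¹ * ((y - x) * (x ⁻¹ * y ⁻¹))            ≈⟨ *-congˡ (begin
      (y - x) * (x ⁻¹ * y ⁻¹)                         ≈⟨ *-distribʳ-minus _ _ _ ⟩
      y * (x ⁻¹ * y ⁻¹) - x * (x ⁻¹ * y ⁻¹)           ≈⟨ +-cong
        (trans (solve 3 (λ y u v → y :* (u :* v) := (v :* y) :* u) refl y (x ⁻¹) (y ⁻¹))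
               (trans (*-congʳ (⁻¹-inverse y≉0)) (*-identityˡ _)))
        (-‿cong (trans (solve 3 (λ x u v → x :* (u :* v) := (u :* x) :* v) refl x (x ⁻¹) (y ⁻¹))
               (trans (*-congʳ (⁻¹-inverse x≉0)) (*-identityˡ _)))) ⟩
      x ⁻¹ - y ⁻¹                                     ∎) ⟩
    (y - x) ⁻¹ * (x ⁻¹ - y ⁻¹)                        ≈⟨ *-distribˡ-minus _ _ _ ⟩
    (y - x) ⁻¹ * x ⁻¹ - (y - x) ⁻¹ * y ⁻¹             ∎

  -- Each use of partial fractions moves one unit of exponent from `a` or `b` to the difference;
  -- repetition ends when one of the two has left the denominator.
  DistinctPairs-step : ∀ {σ ψ} → IsSemiCharacter σ → IsSemiCharacter ψ → ∀ n m j d →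
    DistinctPairs d (PairTerm σ ψ (suc n) (suc m) j) ≈
    DistinctPairs d (PairTerm σ ψ (suc n) m (suc j)) - DistinctPairs d (PairTerm σ ψ n (suc m) (suc j))
  DistinctPairs-step {σ} {ψ} σ-semi ψ-semi n m j d = trans
    (DistinctPairs-cong d (PairTerm-cong σ-semi ψ-semi (suc n) (suc m) j)
      (λ {a} {a′} {b} {b′} a≈a′ b≈b′ → +-cong
        (PairTerm-cong σ-semi ψ-semi (suc n) m (suc j) {a} {a′} {b} {b′} a≈a′ b≈b′)
        (-‿cong (PairTerm-cong σ-semi ψ-semi n (suc m) (suc j) {a} {a′} {b} {b′} a≈a′ b≈b′)))
      (λ {a} {b} a-monic b-monic b≉a → step (partialFractions (γ-nonzero a-monic) (γ-nonzero b-monic) b≉a)))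
    (IsAdditive.homo-minus (DistinctPairs-isAdditive d) _ _)
    where
    step : ∀ {s x y z u v w} → x * y ≈ z * x - z * y →
           s * ((x * u) * (y * v) * w) ≈ s * ((x * u) * v * (z * w)) - s * (u * (y * v) * (z * w))
    step {s} {x} {y} {z} {u} {v} {w} xy≈ = begin
      s * ((x * u) * (y * v) * w)
        ≈⟨ solve 6 (λ s x y u v w → s :* ((x :* u) :* (y :* v) :* w) := (x :* y) :* (s :* (u :* v :* w))) refl s x y u v w ⟩
      (x * y) * (s * (u * v * w))                                      ≈⟨ *-congʳ xy≈ ⟩
      (z * x - z * y) * (s * (u * v * w))                              ≈⟨ *-distribʳ-minus _ _ _ ⟩
      (z * x) * (s * (u * v * w)) - (z * y) * (s * (u * v * w))
        ≈⟨ +-cong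
          (solve 6 (λ s x z u v w → (z :* x) :* (s :* (u :* v :* w)) := s :* ((x :* u) :* v :* (z :* w))) refl s x z u v w)
          (-‿cong (solve 6 (λ s y z u v w → (z :* y) :* (s :* (u :* v :* w)) := s :* (u :* (y :* v) :* (z :* w))) refl s y z u v w)) ⟩
      s * ((x * u) * v * (z * w)) - s * (u * (y * v) * (z * w)) ∎

  PowerSum-* : ∀ σ ψ n m d →
    PowerSum σ n d * PowerSum ψ m d ≈ PowerSum (σ ⊗ ψ) (n ℕ.+ m) d + DistinctPairs d (PairTerm σ ψ n m 0)
  PowerSum-* σ ψ n m d = begin
    PowerSum σ n d * PowerSum ψ m d
      ≈⟨ Sum-*ʳ (monics card d) _ _ ⟨
    Monics d (λ a → (σ a * X a ^ n) * PowerSum ψ m d)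
      ≈⟨ Sum-cong (monics card d) (λ a → trans (sym (Sum-*ˡ (monics card d) _ _)) (Sum-cong (monics card d) (λ b →
           solve 4 (λ s u t v → (s :* u) :* (t :* v) := (s :* t) :* (u :* v :* con 1)) refl _ _ _ _))) ⟩
    MonicPairs d K
      ≈⟨ x+y-x≈y (Monics d (λ a → K (a , a))) _ ⟨
    (Monics d (λ a → K (a , a)) + MonicPairs d K) - Monics d (λ a → K (a , a))
      ≈⟨ +-assoc _ _ _ ⟩
    Monics d (λ a → K (a , a)) + DistinctPairs d K
      ≈⟨ +-congʳ (Sum-cong (monics card d) (λ a → *-congˡ (trans (*-identityʳ _) (sym (^-homo-* (X a) n m))))) ⟩
    PowerSum (σ ⊗ ψ) (n ℕ.+ m) d + DistinctPairs d K ∎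
    where
    K = PairTerm σ ψ n m 0

  -- The part of a multiple sum of depth two whose first polynomial has degree exactly `d`. As `f`
  -- is a function of `d`, its semi-characters and exponents cannot depend on `d`.
  record Depth2 (w : ℕ) (χ : Poly → Carrier) (f : ℕ → Carrier) : Set (c ⊔ c′ ⊔ ℓ′) where
    constructor depth2
    field
      {ρ τ} : Poly → Carrier
      {i j} : ℕ
      ρ-semiCharacter : IsSemiCharacter ρ
      τ-semiCharacter : IsSemiCharacter τ
      i>0 : 0 < i
      j>0 : 0 < j
      ρ⊗τ≗χ : (ρ ⊗ τ) ≗ χ
      i+j≡w : i ℕ.+ j ≡ w
      f≗ : ∀ d → f d ≈ PowerSum ρ i d * below d (PowerSum τ j)

  private
    -- This is the distinct-pair sum with `b` gone from the denominator, rewritten by `b = a + x c`.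
    -- The value of the second semi-character is left as an argument `f` of `(a , x • c)`, in which
    -- the whole is additive, so that its expansion can be inserted term by term.
    BaseOperator : (Poly → Carrier) → (n j d : ℕ) → (Poly × Poly → Carrier) → Carrier
    BaseOperator σ n j d f =
      Monics d (λ a → (σ a * X a ^ n) * Sum* (λ x → MonicsBelow d (λ c → X (x • c) ^ j * f (a , x • c))))

    BaseOperator-isAdditive : ∀ σ n j d → IsAdditive (BaseOperator σ n j d)
    BaseOperator-isAdditive σ n j d = Sum-additive (monics card d) (λ a → *ˡ-additive _
      (minus-additive (Sum-additive elements (λ x → inner a x)) (inner a F.0#)))
      where
      inner : ∀ a x → IsAdditive (λ f → MonicsBelow d (λ c → X (x • c) ^ j * f (a , x • c)))
      inner a x = Sum-additive (upTo d) (λ e → Sum-additive (monics card e) (λ c → *ˡ-additive _ (eval-additive (a , x • c))))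

    PairTerm-base : ∀ {σ ψ} → IsSemiCharacter σ → IsSemiCharacter ψ → ∀ n j d →
      DistinctPairs d (PairTerm σ ψ n 0 j) ≈ BaseOperator σ n j d (λ x → ψ (proj₁ x +ᴬ proj₂ x))
    PairTerm-base {σ} {ψ} σ-semi ψ-semi n j d = trans
      (DistinctPairs-difference d (PairTerm-cong σ-semi ψ-semi n 0 j))
      (Sum-cong (monics card d) (λ a → trans
        (IsAdditive.cong Sum*-additive (λ x → trans
          (IsAdditive.cong (MonicsBelow-isAdditive d) (λ c → trans
            (*-congˡ (*-congˡ (^-congˡ j (⁻¹-cong (γ-difference a x c)))))
            (solve 4 (λ s t u v → (s :* t) :* (u :* con 1 :* v) := (s :* u) :* (v :* t)) refl
              (σ a) (ψ (a +ᴬ x • c)) (X a ^ n) (X (x • c) ^ j))))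
          (MonicsBelow-*ˡ d (σ a * X a ^ n) _)))
        (Sum*-*ˡ _ _)))

    -- Homogeneity of `τ` and linearity of `γ` pull the scalar out of τ(x c) / γ(x c)^(j+1). What is
    -- left to sum over `x` is the character `u`, the power of `x` with exponent h - j - 1, so the
    -- coefficient is 0 or -1.
    BaseOperator-split : ∀ {σ} → IsSemiCharacter σ → ∀ n j {w ψ f} → suc n ℕ.+ suc j ≡ w → f ∈ Split ψ →
      (λ d → BaseOperator σ (suc n) (suc j) d f) ∈ AddSpan (Depth2 w (σ ⊗ ψ))
    BaseOperator-split {σ} σ-semi n j {w} {ψ} {f} n+j≡w (split {ρ} {τ} ρ-semi τ-semi ρ⊗τ≗ψ f≗)
      with semiCharacter-homogeneous τ-semi
    ... | h , τ-hom = finish (Sum*-character u-cong u-homo)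
      where
      u : F.Carrier → Carrier
      u x = ι x ^ h * ι x ⁻¹ ^ suc j
      u-cong : CongruentF u
      u-cong x≈y = *-cong (^-congˡ h (ι.⟦⟧-cong x≈y)) (^-congˡ (suc j) (⁻¹-cong (ι.⟦⟧-cong x≈y)))
      u-homo : ∀ {x y} → ¬ x F.≈ F.0# → ¬ y F.≈ F.0# → u (x F.* y) ≈ u x * u y
      u-homo {x} {y} x≉0 y≉0 = trans
        (*-cong (trans (^-congˡ h (ι.*-homo x y)) (^-distrib-* (ι x) (ι y) h))
          (trans (^-congˡ (suc j) (trans (⁻¹-cong (ι.*-homo x y)) (⁻¹-distrib-* (ι-nonzero x≉0) (ι-nonzero y≉0))))
                 (^-distrib-* (ι x ⁻¹) (ι y ⁻¹) (suc j))))
        (interchange _ _ _ _)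
      g′ : Poly × Poly → Carrier
      g′ x = ρ (proj₁ x) * τ (proj₂ x)
      Bτ : ℕ → Carrier
      Bτ d = below d (PowerSum τ (suc j))
      termwise : ∀ {x e c} → ¬ x F.≈ F.0# → Monic e c → ∀ a →
                 X (x • c) ^ suc j * g′ (a , x • c) ≈ (u x * ρ a) * (τ c * X c ^ suc j)
      termwise {x} {e} {c} x≉0 c-monic a = trans
        (*-cong
          (trans (^-congˡ (suc j) (trans (⁻¹-cong (γ.*ₗ-homo x c)) (⁻¹-distrib-* (ι-nonzero x≉0) (γ-nonzero c-monic))))
                 (^-distrib-* (ι x ⁻¹) (X c) (suc j)))
          (*-congˡ (τ-hom x c)))
        (solve 5 (λ s t r v w → (s :* t) :* (r :* (v :* w)) := ((v :* s) :* r) :* (w :* t)) refl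
          (ι x ⁻¹ ^ suc j) (X c ^ suc j) (ρ a) (ι x ^ h) (τ c))
      inner : ∀ d a → Sum* (λ x → MonicsBelow d (λ c → X (x • c) ^ suc j * g′ (a , x • c))) ≈ (ρ a * Bτ d) * Sum* u
      inner d a = trans
        -- At `x` zero both sides contain an inverse of zero, so they are compared only at nonzero
        -- scalars.
        (Sum*-cong
          (λ x≈y → IsAdditive.cong (MonicsBelow-isAdditive d) (λ c →
            *-cong (^-congˡ (suc j) (X-cong (•-congʳ x≈y c))) (*-congˡ (semiCharacter-cong τ-semi (•-congʳ x≈y c)))))
          (λ x≈y → *-congˡ (u-cong x≈y))
          (λ x x≉0 → trans
            (MonicsBelow-cong d (λ _ c-monic → termwise x≉0 c-monic a))
            (trans (MonicsBelow-*ˡ d (u x * ρ a) _)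
                   (solve 3 (λ u r b → (u :* r) :* b := (r :* b) :* u) refl (u x) (ρ a) (Bτ d)))))
        (Sum*-*ˡ (ρ a * Bτ d) u)
      value : ∀ d → BaseOperator σ (suc n) (suc j) d f ≈ Sum* u * (PowerSum (σ ⊗ ρ) (suc n) d * Bτ d)
      value d = begin
        BaseOperator σ (suc n) (suc j) d f     ≈⟨ IsAdditive.cong (BaseOperator-isAdditive σ (suc n) (suc j) d) f≗ ⟩
        BaseOperator σ (suc n) (suc j) d g′
          ≈⟨ Sum-cong (monics card d) (λ a → trans (*-congˡ (inner d a))
               (solve 5 (λ s x r b u → (s :* x) :* ((r :* b) :* u) := ((s :* r) :* x) :* (b :* u)) refl
                 (σ a) (X a ^ suc n) (ρ a) (Bτ d) (Sum* u))) ⟩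
        Monics d (λ a → ((σ a * ρ a) * X a ^ suc n) * (Bτ d * Sum* u))
          ≈⟨ Sum-*ʳ (monics card d) _ _ ⟩
        PowerSum (σ ⊗ ρ) (suc n) d * (Bτ d * Sum* u)
          ≈⟨ solve 3 (λ p b u → p :* (b :* u) := u :* (p :* b)) refl _ (Bτ d) (Sum* u) ⟩
        Sum* u * (PowerSum (σ ⊗ ρ) (suc n) d * Bτ d) ∎
      finish : Sum* u ≈ 0# ⊎ Sum* u ≈ - 1# → (λ d → BaseOperator σ (suc n) (suc j) d f) ∈ AddSpan (Depth2 w (σ ⊗ ψ))
      finish (inj₁ u≈0) = resp-∈ (λ d → sym (trans (value d) (trans (*-congʳ u≈0) (zeroˡ _)))) 0-∈
      finish (inj₂ u≈-1) = resp-∈ (λ d → sym (trans (value d) (trans (*-congʳ u≈-1) (-1*x≈-x _))))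
        (neg-∈ (gen-∈ (depth2 (⊗-semiCharacter σ-semi ρ-semi) τ-semi (ℕ.s≤s ℕ.z≤n) (ℕ.s≤s ℕ.z≤n)
          (λ a → trans (*-assoc _ _ _) (*-congˡ (ρ⊗τ≗ψ a))) n+j≡w (λ _ → refl))))

  DistinctPairs-base : ∀ {σ ψ} → IsSemiCharacter σ → IsSemiCharacter ψ → ∀ n j {w} → suc n ℕ.+ suc j ≡ w →
    (λ d → DistinctPairs d (PairTerm σ ψ (suc n) 0 (suc j))) ∈ AddSpan (Depth2 w (σ ⊗ ψ))
  DistinctPairs-base {σ} σ-semi ψ-semi n j n+j≡w = resp-∈
    (λ d → sym (PairTerm-base σ-semi ψ-semi (suc n) (suc j) d))
    (AddSpan-map (BaseOperator-isAdditive σ (suc n) (suc j)) (BaseOperator-split σ-semi n j n+j≡w)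
      (semiCharacter-split ψ-semi))

  DistinctPairs-*ˡ : ∀ d k f → DistinctPairs d (λ x → k * f x) ≈ k * DistinctPairs d f
  DistinctPairs-*ˡ d k f = trans
    (+-cong (trans (Sum-cong (monics card d) (λ a → Sum-*ˡ (monics card d) k _)) (Sum-*ˡ (monics card d) k _))
            (-‿cong (Sum-*ˡ (monics card d) k _)))
    (sym (*-distribˡ-minus _ _ k))

  ⁻¹-neg : ∀ {x} → ¬ x ≈ 0# → (- x) ⁻¹ ≈ - 1# * x ⁻¹
  ⁻¹-neg {x} x≉0 = sym (⁻¹-unique (begin
    - x * (- 1# * x ⁻¹)       ≈⟨ solve 3 (λ x y z → x :* (y :* z) := (y :* x) :* z) refl (- x) (- 1#) (x ⁻¹) ⟩
    (- 1# * - x) * x ⁻¹       ≈⟨ *-congʳ (trans (-1*x≈-x _) (-‿involutive x)) ⟩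
    x * x ⁻¹                  ≈⟨ *-comm _ _ ⟩
    x ⁻¹ * x                  ≈⟨ ⁻¹-inverse x≉0 ⟩
    1#                        ∎))

  -- Exchanging the two polynomials negates γ(b) - γ(a), hence the sign. Terms in which `a` has left
  -- the denominator are thereby brought to the form of `DistinctPairs-base`.
  DistinctPairs-flip : ∀ {σ ψ} → IsSemiCharacter σ → IsSemiCharacter ψ → ∀ m j d →
    DistinctPairs d (PairTerm σ ψ 0 m j) ≈ (- 1#) ^ j * DistinctPairs d (PairTerm ψ σ m 0 j)
  DistinctPairs-flip {σ} {ψ} σ-semi ψ-semi m j d = begin
    DistinctPairs d (PairTerm σ ψ 0 m j)
      ≈⟨ DistinctPairs-swap d _ ⟩
    DistinctPairs d (λ x → PairTerm σ ψ 0 m j (proj₂ x , proj₁ x))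
      ≈⟨ DistinctPairs-cong d
           (λ {a} {a′} {b} {b′} a≈a′ b≈b′ → PairTerm-cong σ-semi ψ-semi 0 m j {b} {b′} {a} {a′} b≈b′ a≈a′)
           (λ {a} {a′} {b} {b′} a≈a′ b≈b′ → *-congˡ (PairTerm-cong ψ-semi σ-semi m 0 j {a} {a′} {b} {b′} a≈a′ b≈b′))
           (λ {a} {b} _ _ b≉a → trans
             (*-congˡ (*-congˡ (trans
               (^-congˡ j (trans (⁻¹-cong (sym (-‿swap (γ b) (γ a)))) (⁻¹-neg b≉a)))
               (^-distrib-* (- 1#) (Z (a , b)) j))))
             (solve 5 (λ s t x n z → (s :* t) :* (con 1 :* x :* (n :* z)) := n :* ((t :* s) :* (x :* con 1 :* z))) refl
               (σ b) (ψ a) (X a ^ m) ((- 1#) ^ j) (Z (a , b) ^ j))) ⟩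
    DistinctPairs d (λ x → (- 1#) ^ j * PairTerm ψ σ m 0 j x)
      ≈⟨ DistinctPairs-*ˡ d _ _ ⟩
    (- 1#) ^ j * DistinctPairs d (PairTerm ψ σ m 0 j) ∎

  AddSpan-sign : ∀ {Y : Set a} {G : Pred (Y → Carrier) g} j {f} → f ∈ AddSpan G → (λ x → (- 1#) ^ j * f x) ∈ AddSpan G
  AddSpan-sign zero    f∈ = resp-∈ (λ x → sym (*-identityˡ _)) f∈
  AddSpan-sign (suc j) f∈ = resp-∈ (λ x → trans (sym (-1*x≈-x _)) (sym (*-assoc _ _ _))) (neg-∈ (AddSpan-sign j f∈))

  Depth2-resp : ∀ {w χ χ′} → χ ≗ χ′ → ∀ {f} → f ∈ Depth2 w χ → f ∈ Depth2 w χ′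
  Depth2-resp χ≗χ′ (depth2 ρ τ i>0 j>0 ρτ≗χ i+j≡w f≗) = depth2 ρ τ i>0 j>0 (λ a → trans (ρτ≗χ a) (χ≗χ′ a)) i+j≡w f≗

  -- Every round through `DistinctPairs-split` lowers one of `n`, `m` and keeps the other, until one
  -- is zero; they never vanish together. The exponent `suc j` is positive because a difference has
  -- entered the denominator, and it becomes the exponent of the second power sum.
  DistinctPairs-reduce : ∀ {σ ψ} → IsSemiCharacter σ → IsSemiCharacter ψ → ∀ n m j {w} → 0 < n ℕ.+ m → n ℕ.+ m ℕ.+ suc j ≡ w →
    (λ d → DistinctPairs d (PairTerm σ ψ n m (suc j))) ∈ AddSpan (Depth2 w (σ ⊗ ψ))
  DistinctPairs-split : ∀ {σ ψ} → IsSemiCharacter σ → IsSemiCharacter ψ → ∀ n m j {w} → suc n ℕ.+ suc m ℕ.+ j ≡ w →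
    (λ d → DistinctPairs d (PairTerm σ ψ (suc n) (suc m) j)) ∈ AddSpan (Depth2 w (σ ⊗ ψ))

  DistinctPairs-reduce σ ψ (suc n) zero    j _ eq = DistinctPairs-base σ ψ n j
    (≡.trans (≡.cong (ℕ._+ suc j) (≡.sym (ℕ.+-identityʳ (suc n)))) eq)
  DistinctPairs-reduce σ ψ zero    (suc m) j _ eq = resp-∈ (λ d → sym (DistinctPairs-flip σ ψ (suc m) (suc j) d))
    (AddSpan-sign (suc j) (AddSpan-⊆ (Depth2-resp (λ a → *-comm _ _)) (DistinctPairs-base ψ σ m j eq)))
  DistinctPairs-reduce σ ψ (suc n) (suc m) j _ eq = DistinctPairs-split σ ψ n m (suc j) eq

  DistinctPairs-split σ ψ n m j eq = resp-∈ (λ d → sym (DistinctPairs-step σ ψ n m j d)) (+-∈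
    (DistinctPairs-reduce σ ψ (suc n) m j (ℕ.s≤s ℕ.z≤n) (≡.trans (shift (suc n) m j) eq))
    (neg-∈ (DistinctPairs-reduce σ ψ n (suc m) j (ℕ.≤-trans (ℕ.s≤s ℕ.z≤n) (ℕ.m≤n+m (suc m) n))
      (≡.trans (ℕ.+-suc (n ℕ.+ suc m) j) eq))))
    where
    shift : ∀ n m j → n ℕ.+ m ℕ.+ suc j ≡ n ℕ.+ suc m ℕ.+ j
    shift n m j = ≡.trans (ℕ.+-suc (n ℕ.+ m) j) (≡.cong (ℕ._+ j) (≡.sym (ℕ.+-suc n m)))

  DistinctPairs-positive : ∀ {σ ψ n m} → IsSemiCharacter σ → IsSemiCharacter ψ → 0 < n → 0 < m →
    (λ d → DistinctPairs d (PairTerm σ ψ n m 0)) ∈ AddSpan (Depth2 (n ℕ.+ m) (σ ⊗ ψ))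
  DistinctPairs-positive {n = suc n} {suc m} σ ψ _ _ = DistinctPairs-split σ ψ n m 0 (ℕ.+-identityʳ _)

  -- Words and their quasi-shuffle product

  -- Word r w χ f: f is the sequence of partial sums of a multiple sum of
  -- depth at most r, weight w and character χ.
  data Word : ℕ → ℕ → (Poly → Carrier) → Pred (ℕ → Carrier) (c ⊔ c′ ⊔ ℓ′) where
    nil  : ∀ {r χ f} → 𝟏 ≗ χ → (∀ D → f D ≈ 1#) → Word r 0 χ f
    cons : ∀ {r n m k σ ψ χ f g} → IsSemiCharacter σ → 0 < n → g ∈ Word r m ψ → (σ ⊗ ψ) ≗ χ → n ℕ.+ m ≡ k →
           (∀ D → f D ≈ below D (λ d → PowerSum σ n d * g d)) → Word (suc r) k χ f

  Word-resp : ∀ {r s w w′ χ χ′ f f′} → r ℕ.≤ s → w ≡ w′ → χ ≗ χ′ → (∀ D → f D ≈ f′ D) → f ∈ Word r w χ → f′ ∈ Word s w′ χ′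
  Word-resp r≤s ≡.refl χ≗χ′ f≗f′ (nil 𝟏≗χ f≗1) =
    nil (λ a → trans (𝟏≗χ a) (χ≗χ′ a)) (λ D → trans (sym (f≗f′ D)) (f≗1 D))
  Word-resp (ℕ.s≤s r≤s) ≡.refl χ≗χ′ f≗f′ (cons σ n>0 g∈ σψ≗χ eq f≗) =
    cons σ n>0 (Word-resp r≤s ≡.refl (λ _ → refl) (λ _ → refl) g∈)
      (λ a → trans (σψ≗χ a) (χ≗χ′ a)) eq (λ D → trans (sym (f≗f′ D)) (f≗ D))

  Word-single : ∀ {σ n} → IsSemiCharacter σ → 0 < n → (λ D → below D (PowerSum σ n)) ∈ Word 1 n σ
  Word-single σ n>0 = cons σ n>0 (nil (λ _ → refl) (λ _ → refl)) (λ _ → *-identityʳ _) (ℕ.+-identityʳ _)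
    (λ D → Sum-cong (upTo D) (λ d → sym (*-identityʳ _)))

  Words-resp : ∀ {r s w w′ χ χ′ f f′} → r ℕ.≤ s → w ≡ w′ → χ ≗ χ′ → (∀ D → f D ≈ f′ D) →
               f ∈ AddSpan (Word r w χ) → f′ ∈ AddSpan (Word s w′ χ′)
  Words-resp r≤s eq χ≗χ′ f≗f′ f∈ = resp-∈ f≗f′ (AddSpan-⊆ (Word-resp r≤s eq χ≗χ′ (λ _ → refl)) f∈)

  Words-cons : ∀ {r n m σ ψ f} → IsSemiCharacter σ → 0 < n → f ∈ AddSpan (Word r m ψ) →
    (λ D → below D (λ d → PowerSum σ n d * f d)) ∈ AddSpan (Word (suc r) (n ℕ.+ m) (σ ⊗ ψ))
  Words-cons σ n>0 = AddSpan-map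
    (λ D → Sum-additive (upTo D) (λ d → *ˡ-additive _ (eval-additive d)))
    (λ g∈ → gen-∈ (cons σ n>0 g∈ (λ _ → refl) ≡.refl (λ _ → refl)))

  -- The induction is on a bound `N` for the total depth, not on the words: off the diagonal one
  -- factor is a word produced by an earlier product, of which only the depth is known. Hence the
  -- depth index of `Word`.
  shuffle : ∀ N {r s m n χ ψ f g} → r ℕ.+ s ℕ.≤ N → f ∈ Word r m χ → g ∈ Word s n ψ →
            (λ D → f D * g D) ∈ AddSpan (Word (r ℕ.+ s) (m ℕ.+ n) (χ ⊗ ψ))
  shuffle N {r} {s} r+s≤N (nil 𝟏≗χ f≗1) g∈ = gen-∈ (Word-resp (ℕ.m≤n+m s r) ≡.refl
    (λ a → trans (sym (*-identityˡ _)) (*-congʳ (𝟏≗χ a)))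
    (λ D → trans (sym (*-identityˡ _)) (*-congʳ (sym (f≗1 D)))) g∈)
  shuffle N {r} {s} r+s≤N f∈@(cons _ _ _ _ _ _) (nil 𝟏≗ψ g≗1) = gen-∈ (Word-resp (ℕ.m≤m+n r s) (≡.sym (ℕ.+-identityʳ _))
    (λ a → trans (sym (*-identityʳ _)) (*-congˡ (𝟏≗ψ a)))
    (λ D → trans (sym (*-identityʳ _)) (*-congˡ (sym (g≗1 D)))) f∈)
  shuffle (suc N) {suc r} {suc s} {χ = χ} {ψ} {f} {g} (ℕ.s≤s r+s≤N)
    f∈@(cons {n = i} {m} {σ = σ} {ρ} {g = f′} σ-semi i>0 f′∈ σρ≗χ ≡.refl f≗)
    g∈@(cons {n = j} {n} {σ = τ} {φ} {g = g′} τ-semi j>0 g′∈ τφ≗ψ ≡.refl g≗) =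
    -- In `left` and `right` the leading degrees of the two chains differ; in `diagonal` and
    -- `offDiagonal` they agree, with equal or distinct leading polynomials.
    resp-∈ product (+-∈ (+-∈ left right) (+-∈ diagonal offDiagonal))
    where
    Target : Pred (ℕ → Carrier) _
    Target = AddSpan (Word (suc r ℕ.+ suc s) ((i ℕ.+ m) ℕ.+ (j ℕ.+ n)) (χ ⊗ ψ))

    r+s<N : suc (r ℕ.+ s) ℕ.≤ N
    r+s<N = ℕ.≤-trans (ℕ.≤-reflexive (≡.sym (ℕ.+-suc r s))) r+s≤N

    left : (λ D → below D (λ d → PowerSum σ i d * (f′ d * g d))) ∈ Target
    left = Words-resp ℕ.≤-refl (≡.sym (ℕ.+-assoc i m (j ℕ.+ n)))
      (λ a → trans (sym (*-assoc _ _ _)) (*-congʳ (σρ≗χ a))) (λ _ → refl)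
      (Words-cons σ-semi i>0 (shuffle N r+s≤N f′∈ g∈))

    right : (λ D → below D (λ d → PowerSum τ j d * (f d * g′ d))) ∈ Target
    right = Words-resp (ℕ.≤-reflexive (≡.cong suc (≡.sym (ℕ.+-suc r s)))) (ℕ+.x∙yz≈y∙xz j (i ℕ.+ m) n)
      (λ a → trans (solve 3 (λ t x y → t :* (x :* y) := x :* (t :* y)) refl _ _ _) (*-congˡ (τφ≗ψ a))) (λ _ → refl)
      (Words-cons τ-semi j>0 (shuffle N r+s<N f∈ g′∈))

    tails : (λ d → f′ d * g′ d) ∈ AddSpan (Word (r ℕ.+ s) (m ℕ.+ n) (ρ ⊗ φ))
    tails = shuffle N (ℕ.≤-trans (ℕ.n≤1+n _) r+s<N) f′∈ g′∈

    diagonal : (λ D → below D (λ d → PowerSum (σ ⊗ τ) (i ℕ.+ j) d * (f′ d * g′ d))) ∈ Target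
    -- The two leading letters merge into one, so the depth falls one short of the target; an upper
    -- bound on depth absorbs this.
    diagonal = Words-resp (ℕ.s≤s (ℕ.+-monoʳ-≤ r (ℕ.n≤1+n s))) (ℕ+.interchange i j m n)
      (λ a → trans (interchange _ _ _ _) (*-cong (σρ≗χ a) (τφ≗ψ a))) (λ _ → refl)
      (Words-cons (⊗-semiCharacter σ-semi τ-semi) (ℕ.≤-trans i>0 (ℕ.m≤m+n i j)) tails)

    offDiagonal : (λ D → below D (λ d → DistinctPairs d (PairTerm σ τ i j 0) * (f′ d * g′ d))) ∈ Target
    offDiagonal = AddSpan-map
      (λ D → Sum-additive (upTo D) (λ d → *ʳ-additive _ (eval-additive d)))
      -- The power sum of exponent `l` and `tails` both run below degree `d`. Their product has
      -- total depth at most `suc (r + s)`, one less than the target, so the induction applies to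
      -- it.
      (λ { (depth2 {i = k} {l} α-semi β-semi k>0 l>0 αβ≗ k+l≡ t≗) →
        Words-resp (ℕ.≤-reflexive (≡.cong suc (≡.sym (ℕ.+-suc r s))))
          (≡.trans (≡.sym (ℕ.+-assoc k l (m ℕ.+ n)))
            (≡.trans (≡.cong (ℕ._+ (m ℕ.+ n)) k+l≡) (ℕ+.interchange i j m n)))
          (λ a → trans (trans (sym (*-assoc _ _ _)) (trans (*-congʳ (αβ≗ a)) (interchange _ _ _ _))) (*-cong (σρ≗χ a) (τφ≗ψ a)))
          (λ D → Sum-cong (upTo D) (λ d → trans (sym (*-assoc _ _ _)) (*-congʳ (sym (t≗ d)))))
          (Words-cons α-semi k>0 (AddSpan-map (λ d → *ˡ-additive _ (eval-additive d))
            (shuffle N r+s<N (Word-single β-semi l>0)) tails)) })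
      (DistinctPairs-positive σ-semi τ-semi i>0 j>0)

    product : ∀ D →
      (below D (λ d → PowerSum σ i d * (f′ d * g d)) + below D (λ d → PowerSum τ j d * (f d * g′ d))) +
      (below D (λ d → PowerSum (σ ⊗ τ) (i ℕ.+ j) d * (f′ d * g′ d)) +
       below D (λ d → DistinctPairs d (PairTerm σ τ i j 0) * (f′ d * g′ d)))
      ≈ f D * g D
    product D = sym (begin
      f D * g D
        ≈⟨ *-cong (f≗ D) (g≗ D) ⟩
      below D (λ d → PowerSum σ i d * f′ d) * below D (λ d → PowerSum τ j d * g′ d)
        ≈⟨ below-* D _ _ ⟩
      (below D (λ d → PowerSum σ i d * f′ d * below d (λ d → PowerSum τ j d * g′ d)) +
       below D (λ d → PowerSum τ j d * g′ d * below d (λ d → PowerSum σ i d * f′ d))) +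
      below D (λ d → PowerSum σ i d * f′ d * (PowerSum τ j d * g′ d))
        ≈⟨ +-cong (+-cong
             (Sum-cong (upTo D) (λ d → trans (*-assoc _ _ _) (*-congˡ (*-congˡ (sym (g≗ d))))))
             (Sum-cong (upTo D) (λ d → trans (*-assoc _ _ _) (*-congˡ (trans (*-comm _ _) (*-congʳ (sym (f≗ d))))))))
             (Sum-cong (upTo D) (λ d → trans (interchange _ _ _ _)
               (trans (*-congʳ (PowerSum-* σ τ i j d)) (distribʳ _ _ _)))) ⟩
      (below D (λ d → PowerSum σ i d * (f′ d * g d)) + below D (λ d → PowerSum τ j d * (f d * g′ d))) +
      below D (λ d → PowerSum (σ ⊗ τ) (i ℕ.+ j) d * (f′ d * g′ d) + DistinctPairs d (PairTerm σ τ i j 0) * (f′ d * g′ d))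
        ≈⟨ +-congˡ (Sum-+ (upTo D) _ _) ⟩
      _ ∎)

  -- Convergence of multiple sums

  -- A list has zero coefficients from its length on, so it cannot be monic of a degree at or beyond
  -- that length; `N` is the largest length of an exception.
  InverseTendsToZero-monic : ∀ M → ∃ λ N → ∀ {d a} → N ℕ.≤ d → Monic d a → M ⊑ X a
  InverseTendsToZero-monic M = N exceptions , λ N≤d a-monic →
    proj₂ (γ-tends M) _ (Monic⇒≉0 a-monic) (unexceptional exceptions N≤d a-monic)
    where
    exceptions = proj₁ (γ-tends M)
    N : List Poly → ℕ
    N []       = 0
    N (b ∷ bs) = List.length b ℕ.⊔ N bs
    coeff≈0 : ∀ b {d} → List.length b ℕ.≤ d → coeff b d F.≈ F.0#
    coeff≈0 []      _             = F.refl
    coeff≈0 (x ∷ b) (ℕ.s≤s len≤d) = coeff≈0 b len≤d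
    unexceptional : ∀ bs {d a} → N bs ℕ.≤ d → Monic d a → ¬ Any (a ≈ᴬ_) bs
    unexceptional (b ∷ bs) {d} N≤d a-monic (here a≈b)   = F.1≉0 (F.trans (F.sym (Monic⇒coeff≈1 a-monic))
      (F.trans (a≈b d) (coeff≈0 b (ℕ.≤-trans (ℕ.m≤m⊔n _ (N bs)) N≤d))))
    unexceptional (b ∷ bs) {d} N≤d a-monic (there a∈bs) =
      unexceptional bs (ℕ.≤-trans (ℕ.m≤n⊔m (List.length b) _) N≤d) a-monic a∈bs

  PowerSum-null : ∀ {σ n} → IsSemiCharacter σ → 0 < n → Null (PowerSum σ n)
  -- One factor `X a` supplies the bound `M`; the maximum with `0ℚ` keeps the other `n` factors of
  -- nonnegative valuation even when `M` is negative.
  PowerSum-null {σ} {suc n} σ-semi _ M with InverseTendsToZero-monic (M ℚ.⊔ 0ℚ)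
  ... | N , M⊔0⊑X = N , λ d N≤d → ⊑-Sum (monics-Monic d) (λ {a} a-monic →
    ⊑-0* (semiCharacter-⊑ σ-semi a) (⊑-resp (*-comm _ _)
      (⊑-0* (⊑-^ n (≤-⊑ (ℚ.p≤q⊔p M 0ℚ) (M⊔0⊑X N≤d a-monic))) (≤-⊑ (ℚ.p≤p⊔q M 0ℚ) (M⊔0⊑X N≤d a-monic)))))

  -- The tail of the word converges and so is bounded, while the power sum in front of it is null;
  -- the terms of the outer series are therefore null.
  Word-converges : ∀ {r w χ f} → f ∈ Word r w χ → ∃ λ x → ConvergesTo L ν f x
  Word-converges (nil _ f≗1) = 1# , null-resp (λ D → sym (x-x≈0 (f≗1 D))) null-0
  Word-converges (cons {n = n} {σ = σ} {g = g} σ-semi n>0 g∈ _ _ f≗) =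
    proj₁ limit , converges-resp (λ D → sym (f≗ D)) (proj₂ limit)
    where
    limit = null⇒below-converges isComplete {λ d → PowerSum σ n d * g d}
      (null-* {PowerSum σ n} {g} (PowerSum-null σ-semi n>0) (converges⇒bounded {g} (proj₂ (Word-converges g∈))))

  -- Words as explicit sums over chains

  private
    denominator : ∀ {r} → Vec ℕ r → Vec Poly r → Carrier
    denominator ns as = ∏ᵛ (Vec.zipWith (λ a n → γ a ^ n) as ns)

  -- `term` inverts the product of all denominators at once; splitting off the first one is
  -- legitimate only when all of them are nonzero.
  chains-nonzero : ∀ {r} (ns : Vec ℕ r) D → All (λ as → ¬ denominator ns as ≈ 0#) (chains card r D)
  chains-nonzero []       D = 1≉0 ∷ []
  chains-nonzero (n ∷ ns) D = All.concat⁺ (All.map⁺ (All.universal (λ d →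
    All.cartesianProductWith⁺ (≡.setoid _) (≡.setoid _) _∷_ (monics card d) _ (λ a∈ as∈ →
      *-nonzero (^-nonzero n (γ-nonzero (All.lookup (monics-Monic d) a∈))) (All.lookup (chains-nonzero ns d) as∈))) (upTo D)))

  partialSum-[] : ∀ D → partialSum [] [] D ≈ 1#
  partialSum-[] D = trans (+-identityʳ _) (trans (*-identityˡ _) (sym (⁻¹-unique (*-identityˡ 1#))))

  partialSum-∷ : ∀ {r} σ n (σs : Vec (Poly → Carrier) r) ns D →
    partialSum (σ ∷ σs) (n ∷ ns) D ≈ below D (λ d → PowerSum σ n d * partialSum σs ns d)
  partialSum-∷ {r} σ n σs ns D = trans (Sum-concatMap _ (upTo D) _) (Sum-cong (upTo D) (λ d → begin
    Sum (cartesianProductWith _∷_ (monics card d) (chains card r d)) (term (σ ∷ σs) (n ∷ ns))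
      ≈⟨ Sum-cartesianProductWith _∷_ (monics card d) (chains card r d) _ ⟩
    Monics d (λ a → Sum (chains card r d) (λ as → term (σ ∷ σs) (n ∷ ns) (a ∷ as)))
      ≈⟨ Sum-congᴬ (monics-Monic d) (λ a-monic → trans
           (Sum-congᴬ (chains-nonzero ns d) (λ as≉0 → trans
             (*-congˡ (trans (⁻¹-distrib-* (^-nonzero n (γ-nonzero a-monic)) as≉0)
                             (*-congʳ (⁻¹-distrib-^ n (γ-nonzero a-monic)))))
             (interchange _ _ _ _)))
           (Sum-*ˡ (chains card r d) _ (term σs ns))) ⟩
    Monics d (λ a → (σ a * X a ^ n) * partialSum σs ns d)
      ≈⟨ Sum-*ʳ (monics card d) _ _ ⟩
    PowerSum σ n d * partialSum σs ns d ∎))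

  partialSum-Word : ∀ {r} {σs : Vec (Poly → Carrier) r} {ns} → VecAll.All IsSemiCharacter σs → VecAll.All (0 <_) ns →
    partialSum σs ns ∈ Word r (Vec.sum ns) (⨂ σs)
  partialSum-Word {ns = []} VecAll.[] VecAll.[] = nil (λ _ → refl) partialSum-[]
  partialSum-Word {ns = _ ∷ _} (σ VecAll.∷ σs) (n>0 VecAll.∷ ns>0) =
    cons σ n>0 (partialSum-Word σs ns>0) (λ _ → refl) ≡.refl (partialSum-∷ _ _ _ _)

  private
    -- `Generator` wants flat vectors and an exact depth, whereas a `Word` is nested and carries
    -- only a bound for its depth.
    record Indices (w : ℕ) (χ : Poly → Carrier) (f : ℕ → Carrier) : Set (c ⊔ c′ ⊔ ℓ′) where
      constructor mkIndices
      field
        {r}  : ℕ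
        {σs} : Vec (Poly → Carrier) r
        {ns} : Vec ℕ r
        semiCharacters : VecAll.All IsSemiCharacter σs
        ns>0 : VecAll.All (0 <_) ns
        ⨂≗χ : ⨂ σs ≗ χ
        ∑≡w : Vec.sum ns ≡ w
        f≗  : ∀ D → f D ≈ partialSum σs ns D

  Word⇒Generator : ∀ {r w χ f x} → 0 < w → f ∈ Word r w χ → ConvergesTo L ν f x → x ∈ Generator w χ
  Word⇒Generator {w = w} {χ} {f} w>0 f∈ f→x = generator (indices f∈)
    where
    indices : ∀ {r w χ f} → f ∈ Word r w χ → Indices w χ f
    indices (nil 𝟏≗χ f≗1) =
      mkIndices VecAll.[] VecAll.[] 𝟏≗χ ≡.refl (λ D → trans (f≗1 D) (sym (partialSum-[] D)))
    indices (cons {n = n} σ n>0 g∈ σψ≗χ n+m≡k f≗) with indices g∈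
    ... | mkIndices σs ns>0 ⨂≗ψ ∑≡m g≗ = mkIndices (σ VecAll.∷ σs) (n>0 VecAll.∷ ns>0)
      (λ a → trans (*-congˡ (⨂≗ψ a)) (σψ≗χ a)) (≡.trans (≡.cong (n ℕ.+_) ∑≡m) n+m≡k)
      (λ D → trans (f≗ D) (trans (Sum-cong (upTo D) (λ d → *-congˡ (g≗ d))) (sym (partialSum-∷ _ _ _ _ D))))
    generator : Indices w χ f → Generator w χ _
    generator (mkIndices {zero} {ns = []} _ _ _ ∑≡w _) = contradiction w>0 (ℕ.≤⇒≯ (ℕ.≤-reflexive (≡.sym ∑≡w)))
    generator (mkIndices {suc r} σs ns>0 ⨂≗χ ∑≡w f≗) = record
      { r>0 = ℕ.s≤s ℕ.z≤n ; semiCharacters = σs ; ns>0 = ns>0 ; ⨂σs≗σ = ⨂≗χ ; ∑ns≡n = ∑≡w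
      ; isMultipleSum = converges-resp f≗ f→x }

  -- The combination is the same for every `D`, so its limit is that combination of the limits of
  -- the words. Positive weight excludes the empty word, which is not a generator.
  Words-limit : ∀ {r w χ f} → 0 < w → f ∈ AddSpan (Word r w χ) → ∃ λ x → ConvergesTo L ν f x × x ∈ Span (Generator w χ)
  Words-limit w>0 (gen-∈ f∈) with Word-converges f∈
  ... | x , f→x = x , f→x , gen-∈ (Word⇒Generator w>0 f∈ f→x)
  Words-limit w>0 0-∈ = 0# , converges-0 , 0-∈
  Words-limit w>0 (+-∈ f∈ g∈) with Words-limit w>0 f∈ | Words-limit w>0 g∈
  ... | x , f→x , x∈ | y , g→y , y∈ = x + y , converges-+ f→x g→y , +-∈ x∈ y∈
  Words-limit w>0 (neg-∈ f∈) with Words-limit w>0 f∈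
  ... | x , f→x , x∈ = - x , converges-neg f→x , Span-neg x∈
  Words-limit w>0 (resp-∈ f≗g f∈) with Words-limit w>0 f∈
  ... | x , f→x , x∈ = x , converges-resp f≗g f→x , x∈

  -- The product of the two sequences of partial sums tends to `x * y` and, by `shuffle`, to an
  -- element of the span; limits are unique.
  Generator-* : ∀ {m n σ ψ x y} → 0 < m → x ∈ Generator m σ → y ∈ Generator n ψ →
                (x * y) ∈ Span (Generator (m ℕ.+ n) (σ ⊗ ψ))
  Generator-* {m} {n} m>0 x∈ y∈ with Words-limit (ℕ.≤-trans m>0 (ℕ.m≤m+n m n))
    (Words-resp ℕ.≤-refl (≡.cong₂ ℕ._+_ (∑ns≡n x∈) (∑ns≡n y∈)) (λ a → *-cong (⨂σs≗σ x∈ a) (⨂σs≗σ y∈ a)) (λ _ → refl)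
      (shuffle _ ℕ.≤-refl (partialSum-Word (semiCharacters x∈) (ns>0 x∈)) (partialSum-Word (semiCharacters y∈) (ns>0 y∈))))
    where open Generator
  ... | z , fg→z , z∈ =
    resp-∈ (converges-unique fg→z (converges-* (Generator.isMultipleSum x∈) (Generator.isMultipleSum y∈))) z∈

  -- The spaces `𝓕` and the algebra they span

  𝓕-* : ∀ {m n σ ψ x y} → 0 < m → 0 < n → x ∈ 𝓕 m σ → y ∈ 𝓕 n ψ → (x * y) ∈ 𝓕 (m ℕ.+ n) (σ ⊗ ψ)
  𝓕-* {m} {n} m>0 n>0 (positive _ x∈) (positive _ y∈) =
    positive (ℕ.≤-trans m>0 (ℕ.m≤m+n m n)) (Span-* (Generator-* m>0) x∈ y∈)

  𝓕-total-isSubalgebra : IsSubalgebra 𝓕-total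
  𝓕-total-isSubalgebra = record
    { resp-≈   = resp-∈
    ; 0-closed = 0-∈
    ; +-closed = +-∈
    ; ·-closed = scale-∈
    ; 1-closed = gen-∈ (0 , 𝟏 , 𝟏-semiCharacter , weight0-one (λ _ → refl) 1-∈)
    ; *-closed = Span-* generators
    }
    where
    generators : ∀ {x y} → (∃ λ m → ∃ λ σ → IsSemiCharacter σ × x ∈ 𝓕 m σ) → (∃ λ n → ∃ λ ψ → IsSemiCharacter ψ × y ∈ 𝓕 n ψ) →
                 (x * y) ∈ 𝓕-total
    -- An element of weight 0 is a scalar of `𝔽ₚ` or zero, so multiplying by it stays in the span;
    -- the product rule is left for two positive weights.
    generators (_ , _ , _ , weight0-one _ x∈𝔽ₚ) y∈                     = scale-∈ x∈𝔽ₚ (gen-∈ y∈)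
    generators (_ , _ , _ , weight0-zero x≈0)   y∈                     = resp-∈ (sym (trans (*-congʳ x≈0) (zeroˡ _))) 0-∈
    generators x∈ (_ , _ , _ , weight0-one _ y∈𝔽ₚ)                     = resp-∈ (*-comm _ _) (scale-∈ y∈𝔽ₚ (gen-∈ x∈))
    generators x∈ (_ , _ , _ , weight0-zero y≈0)                       = resp-∈ (sym (trans (*-congˡ y≈0) (zeroʳ _))) 0-∈
    generators (_ , _ , σ , x∈@(positive m>0 _)) (_ , _ , ψ , y∈@(positive n>0 _)) =
      gen-∈ (_ , _ , ⊗-semiCharacter σ ψ , 𝓕-* m>0 n>0 x∈ y∈)

open import Data.Nat.Base using (_^_; _+_)

theorem9p4 : ∀ {c ℓ c′ ℓ′ : Level}
    (p e q : ℕ) → Prime p → 0 < e → q ≡ p ^ e →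
    (F : Field c ℓ) (card : HasCardinality q F) →
    (L : Field c′ ℓ′) (ι : Field.Carrier F → Field.Carrier L) → IsFieldHomomorphism F L ι →
    (ν : Field.Carrier L → ℚ∞) → IsValuation L ν → IsComplete L ν →
    (I : List ℕ) → Unique I → All (0 <_) I →
    (δ : ℕ → Polynomial.Poly F → Field.Carrier L) →
    (γ : Polynomial.Poly F → Field.Carrier L) →
    (∀ {i} → i ∈ˡ I → IsInjectiveLinear F L ι (δ i)) →
    IsInjectiveLinear F L ι γ →
    (∀ {i} → i ∈ˡ I → ∀ a → ν (δ i a) ≡ [ 0ℚ ] ⊎ ν (δ i a) ≡ ∞) →
    InverseTendsToZero F L ν γ →
    let open MultipleSums p F card L ν I δ γ in
    (∀ {m n σ ψ} → 0 < m → 0 < n → IsSemiCharacter σ → IsSemiCharacter ψ →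
    ∀ {x y} → x ∈ 𝓕 m σ → y ∈ 𝓕 n ψ → Field._*_ L x y ∈ 𝓕 (m + n) (σ ⊗ ψ))
    × IsSubalgebra 𝓕-total
theorem9p4 p e q p-prime _ q≡p^e F card L ι ι-homomorphism ν isValuation isComplete I I-unique _ δ γ
  δ-linear γ-linear δ-unit γ-tends =
  (λ m>0 n>0 _ _ x∈ y∈ → 𝓕-* m>0 n>0 x∈ y∈) , 𝓕-total-isSubalgebra
  where
  open QuasiShuffle p e q p-prime q≡p^e F card L ι ι-homomorphism ν isValuation isComplete I I-unique δ γ
    δ-linear γ-linear δ-unit γ-tends
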